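{- Let $n\geq 10$. In PAP on $S_n$ with pattern length $k=4$, the move-by-move reverse strategy is a winning strategy for Player II. Consequently $\operatorname{sg}(S_n,4)=0$.
   Context: $S_n$ is the set of permutations of $\{1,\dots,n\}$ in one-line notation; for $\pi=\pi(1)\cdots\pi(n)$ the reverse is $\pi^r=\pi(n)\cdots\pi(1)$. A permutation $\pi$ contains a pattern $p\in S_k$ if some subsequence $\pi(i_1)\cdots\pi(i_k)$ with $i_1<\cdots<i_k$ is order-isomorphic to $p$; otherwise it avoids $p$. The impartial game PAP with pattern length $k$: a position is a subset $X\subseteq S_n$; a move consists of choosing a pattern $p\in S_k$ contained in at least one permutation of $X$, and replacing $X$ by the permutations of $X$ avoiding $p$. Normal play: a player with no legal move loses. Play starts from $X=S_n$, Player I moving first. The move-by-move reverse strategy for Player II: whenever Player I chooses a pattern $p$, Player II replies by choosing $p^r$. It is a winning strategy if, against every sequence of legal moves by Player I, each such reply $p^r$ is a legal move, so that Player II always makes the last move. The Sprague--Grundy value is $\operatorname{sg}(X)=\operatorname{mex}\{\operatorname{sg}(Y): Y \text{ reachable from } X \text{ in one move}\}$ (terminal positions have value $0$), and $\operatorname{sg}(S_n,k)$ denotes the value of the starting position $S_n$ in PAP with pattern length $k$. -}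

module Defs where

open import Data.Nat using (ℕ)
open import Data.Fin using (Fin; _<_; opposite)
open import Data.Fin.Properties using (opposite-involutive)
open import Data.Product using (Σ; ∃; ∃-syntax; Σ-syntax; _×_; _,_; proj₁)
open import Function using (_∘_; _⇔_)
open import Function.Definitions using (Injective)
open import Relation.Binary.PropositionalEquality using (_≡_; _≢_; cong; sym; trans)
open import Relation.Nullary using (¬_)

-- S_n : permutations of {0,…,n-1} in one-line notation, i.e. injective
-- (hence bijective) maps  i ↦ π(i)  on Fin n.
Perm : ℕ → Set
Perm n = Σ (Fin n → Fin n) (Injective _≡_ _≡_)

_⟨_⟩ : ∀ {n} → Perm n → Fin n → Fin n
π ⟨ i ⟩ = proj₁ π i

opposite-injective : ∀ {n} → Injective {A = Fin n} _≡_ _≡_ opposite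
opposite-injective {x = i} {j} eq =
  trans (sym (opposite-involutive i)) (trans (cong opposite eq) (opposite-involutive j))

reverse : ∀ {n} → Perm n → Perm n
reverse (f , inj) = (f ∘ opposite) , (λ eq → opposite-injective (inj eq))

Contains : ∀ {n k} → Perm n → Perm k → Set
Contains {n} {k} π p =
  Σ[ ι ∈ (Fin k → Fin n) ] ((∀ {a b : Fin k} → a < b → ι a < ι b) ×
          (∀ (a b : Fin k) → (π ⟨ ι a ⟩ < π ⟨ ι b ⟩) ⇔ (p ⟨ a ⟩ < p ⟨ b ⟩)))

Avoids : ∀ {n k} → Perm n → Perm k → Set
Avoids π p = ¬ Contains π p

Position : ℕ → Set₁
Position n = Perm n → Set

Sn : (n : ℕ) → Position n
Sn n _ = Data.Unit.⊤
  where import Data.Unit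

Legal : ∀ {n k} → Position n → Perm k → Set
Legal X p = ∃[ π ] (X π × Contains π p)

move : ∀ {n k} → Position n → Perm k → Position n
move X p π = X π × Avoids π p

-- Sprague–Grundy value, as a relation:  SG k X v  means  sg(X) = v  in PAP
-- with pattern length k.  v is the mex of the values of the options:
-- every option has a value (given by f), no option has value v, and every
-- w < v is the value of some option.  (Terminal positions get 0.)
data SG {n : ℕ} (k : ℕ) (X : Position n) : ℕ → Set₁ where
  sg : (v : ℕ) (f : (p : Perm k) → Legal X p → ℕ) →
       (∀ p (l : Legal X p) → SG k (move X p) (f p l)) →
       (∀ p (l : Legal X p) → f p l ≢ v) →
       (∀ w → w Data.Nat.< v → ∃[ p ] Σ (Legal X p) (λ l → f p l ≡ w)) →
       SG k X v

-- Player I to move at X; Player II uses the move-by-move reverse strategy.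
-- RevWins k X : against every legal move p of Player I, the reply p^r is legal,
-- and the strategy keeps winning from the resulting position.  Being inductive,
-- this also says every play is finite, so Player II makes the last move.
data RevWins {n : ℕ} (k : ℕ) (X : Position n) : Set₁ where
  rw : (∀ (p : Perm k) → Legal X p →
          Σ (Legal (move X p) (reverse p))
            (λ _ → RevWins k (move (move X p) (reverse p)))) →
       RevWins k X

{-# OPTIONS --safe #-}
module Submission where

-- A position reached after Player II's replies consists of the permutations avoiding a reverse-closed
-- set A of patterns.  Since n ≥ 10 > 3 · 3, Erdős–Szekeres forces A to omit 1234 and 4321 as long as the
-- position is non-empty.  So, if some π in the position contains p, it suffices to find a permutation of
-- length n that contains p^r, not p, and whose other patterns are monotone, or are patterns of π or
-- reverses of such.  The permutations used are inflations: one entry of a word of length at most 5 is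
-- replaced by a monotone run, whose length does not affect the set of patterns once it is at least 4.
-- A finite search shows that the patterns of some subsequence of π of length at most 7 containing p
-- always leave room for one of 27 inflations, up to reverse and complement.
--
-- The Grundy value of a position exists because all relevant conditions are decidable, and a position in
-- which every move has a reply leading to a position of the same kind can only have value 0.

open import Defs
open import Data.Nat using (ℕ; _≤_)
open import Data.Product using (_×_)

open import Data.Bool using (Bool; true; false; if_then_else_; _∨_; _∧_; not; T)
open import Data.Bool.ListAction using (all; any)
open import Data.Bool.Properties using (T-≡)
open import Data.Empty using (⊥-elim)
open import Data.Fin as Fin using (Fin; zero; suc; toℕ; fromℕ<; combine; finToFun; funToFin)
open import Data.Fin.Properties as Finₚ
  using (toℕ-injective; toℕ<n; toℕ-fromℕ<; fromℕ<-injective; finToFun-funToFin; pigeonhole; combine-injective)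
open import Data.List as List hiding (all; any; _∷ʳ_; reverse; find)
open import Data.List.Extrema.Nat using (max; xs≤max)
open import Data.List.Membership.Propositional using (_∈_; _∉_; lose)
open import Data.List.Membership.Propositional.Properties
open import Data.List.Properties
open import Data.List.Relation.Binary.Sublist.Propositional using (_⊆_; []; _∷_; _∷ʳ_; ⊆-trans; minimum)
open import Data.List.Relation.Binary.Sublist.Propositional.Properties using (Any-resp-⊆; All-resp-⊆)
open import Data.List.Relation.Unary.All as All using (All; []; _∷_)
open import Data.List.Relation.Unary.All.Properties using (all⁺)
open import Data.List.Relation.Unary.AllPairs using ([]; _∷_)
open import Data.List.Relation.Unary.Any using (here; there)
open import Data.List.Relation.Unary.Unique.Propositional using (Unique)
open import Data.List.Relation.Unary.Unique.Propositional.Properties using (tabulate⁺)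
open import Data.Nat hiding (_≟_)
open import Data.Nat.Induction using (<-wellFounded)
open import Data.Nat.Properties
open import Data.Product as Product using (Σ; ∃; ∃₂; _,_; proj₁; proj₂)
open import Data.Sum as Sum using (_⊎_; inj₁; inj₂)
open import Data.Unit using (⊤; tt)
open import Data.Vec as Vec using (Vec; []; _∷_)
open import Data.Vec.Properties using (lookup∘tabulate)
open import Function using (_∘_; id; _⇔_; mk⇔; Equivalence)
open import Function.Definitions using (Injective)
open import Induction.WellFounded using (Acc; acc)
open import Level using (0ℓ)
open import Relation.Binary.Core using (Rel)
open import Relation.Binary.Definitions using (Decidable; Transitive; tri<; tri≈; tri>)
open import Relation.Binary.PropositionalEquality hiding (resp)
open import Relation.Nullary using (¬_; Dec; yes; no; contradiction)
open import Relation.Nullary.Decidable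
  using (map′; _×-dec_; _→-dec_; ¬?; dec-true; dec-false; decidable-stable; toWitness)

open import Data.List.Membership.DecPropositional _≟_ using (_∈?_)

-- Values of positions

infix 4 _≈_
_≈_ : ∀ {n} → Perm n → Perm n → Set
π ≈ ρ = ∀ i → π ⟨ i ⟩ ≡ ρ ⟨ i ⟩

Contains-resp : ∀ {n k} (π ρ : Perm n) (p q : Perm k) → π ≈ ρ → p ≈ q → Contains π p → Contains ρ q
Contains-resp π ρ p q π≈ρ p≈q (ι , mono , same) = ι , mono , λ a b →
  subst₂ _⇔_ (cong₂ Fin._<_ (π≈ρ (ι a)) (π≈ρ (ι b))) (cong₂ Fin._<_ (p≈q a) (p≈q b)) (same a b)

-- The move relation is well-founded, for arbitrary (even undecidable) positions.
data Terminates {n} k (X : Position n) : Set₁ where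
  terminates : (∀ (p : Perm k) → Legal X p → Terminates k (move X p)) → Terminates k X

-- Once `p` is chosen, no remaining permutation contains a pattern with the code of `p`, so the list
-- of codes covering the legal patterns shrinks. Codes are used because a `Perm` carries an
-- injectivity proof and patterns matter only up to `≈`.
position-terminates : ∀ {n k} (X : Position n) → Terminates k X
position-terminates {n} {k} X = go X (allFin _) (<-wellFounded _) (λ p _ → ∈-allFin _)
  where
  code : Perm k → Fin (k ^ k)
  code p = funToFin (proj₁ p)
  code-injective : ∀ {p q} → code p ≡ code q → p ≈ q
  code-injective {p} {q} eq i = trans (sym (finToFun-funToFin (proj₁ p) i))
    (trans (cong (λ c → finToFun c i) eq) (finToFun-funToFin (proj₁ q) i))
  go : ∀ (X : Position n) cs → Acc _<_ (length cs) → (∀ p → Legal X p → code p ∈ cs) → Terminates k X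
  go X cs (acc rec) covers = terminates λ p l → go (move X p) (filter (λ c → ¬? (c Finₚ.≟ code p)) cs)
    (rec (filter-notAll _ cs (lose (covers p l) (λ ¬eq → ¬eq refl))))
    (λ { q (π , (Xπ , π∌p) , π∋q) → ∈-filter⁺ (λ c → ¬? (c Finₚ.≟ code p)) (covers q (π , Xπ , π∋q))
       (λ eq → π∌p (Contains-resp π π q p (λ _ → refl) (code-injective {q} {p} eq) π∋q)) })

move-cong : ∀ {n k} {X Y : Position n} (p : Perm k) → (∀ π → X π ⇔ Y π) → ∀ π → move X p π ⇔ move Y p π
move-cong p X⇔Y π = mk⇔ (Product.map₁ (X⇔Y π .Equivalence.to)) (Product.map₁ (X⇔Y π .Equivalence.from))

Legal-resp : ∀ {n k} {X Y : Position n} (p : Perm k) → (∀ π → X π ⇔ Y π) → Legal X p → Legal Y p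
Legal-resp p X⇔Y (π , Xπ , π∋p) = π , X⇔Y π .Equivalence.to Xπ , π∋p

-- If `v < w`, the mex condition at `Y` gives an option of value `v`; by induction the same move at
-- `X` also has value `v`, which is excluded. Positions are compared by `⇔` because `≈`-equal
-- patterns lead to equivalent, not identical, positions.
SG-unique : ∀ {n k v w} {X Y : Position n} → (∀ π → X π ⇔ Y π) → SG k X v → SG k Y w → v ≡ w
SG-unique {v = v} {w} X⇔Y (sg .v f f✓ f≢ f-onto) (sg .w g g✓ g≢ g-onto) with <-cmp v w
... | tri≈ _ eq _ = eq
... | tri< v<w _ _ =
  let (p , l , eq) = g-onto v v<w
      l′ = Legal-resp p (λ π → mk⇔ (X⇔Y π .Equivalence.from) (X⇔Y π .Equivalence.to)) l
  in ⊥-elim (f≢ p l′ (trans (SG-unique (move-cong p X⇔Y) (f✓ p l′) (g✓ p l)) eq))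
... | tri> _ _ w<v =
  let (p , l , eq) = f-onto w w<v
      l′ = Legal-resp p X⇔Y l
  in ⊥-elim (g≢ p l′ (trans (sym (SG-unique (move-cong p X⇔Y) (f✓ p l) (g✓ p l′))) eq))

-- A positive value would give an option of value 0. From that option the reply leads to a position
-- whose value is 0 by induction, so the option cannot have value 0 itself.
RevWins⇒SG≡0 : ∀ {n k v} {X : Position n} → RevWins k X → SG k X v → v ≡ 0
RevWins⇒SG≡0 {v = zero} _ _ = refl
RevWins⇒SG≡0 {v = suc v} (rw wins) (sg _ f f✓ f≢ f-onto) with f-onto 0 z<s
... | p , l , fpl≡0 with f p l | f✓ p l | fpl≡0 | wins p l
... | _ | sg _ g g✓ g≢ _ | refl | l′ , win =
  ⊥-elim (g≢ (reverse p) l′ (RevWins⇒SG≡0 win (g✓ (reverse p) l′)))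

-- Decidability of containment and legality

any-fun? : ∀ {m n} {P : (Fin m → Fin n) → Set} → (∀ {f g} → f ≗ g → P f → P g) →
  (∀ f → Dec (P f)) → Dec (∃ P)
any-fun? resp P? = map′ (λ (c , h) → finToFun c , h)
  (λ (f , h) → funToFin f , resp (λ i → sym (finToFun-funToFin f i)) h)
  (Finₚ.any? (λ c → P? (finToFun c)))

_⇔-dec_ : ∀ {A B : Set} → Dec A → Dec B → Dec (A ⇔ B)
a? ⇔-dec b? = map′ (λ (f , g) → mk⇔ f g) (λ e → Equivalence.to e , Equivalence.from e)
  ((a? →-dec b?) ×-dec (b? →-dec a?))

contains? : ∀ {n k} (π : Perm n) (p : Perm k) → Dec (Contains π p)
contains? {n} {k} π p = any-fun? resp λ ι →
  map′ (λ h {a} {b} → h a b) (λ h a b → h)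
       (Finₚ.all? λ a → Finₚ.all? λ b → (a Finₚ.<? b) →-dec (ι a Finₚ.<? ι b))
  ×-dec Finₚ.all? λ a → Finₚ.all? λ b → (π ⟨ ι a ⟩ Finₚ.<? π ⟨ ι b ⟩) ⇔-dec (p ⟨ a ⟩ Finₚ.<? p ⟨ b ⟩)
  where
  resp : ∀ {ι κ : Fin k → Fin n} → ι ≗ κ →
    (∀ {a b} → a Fin.< b → ι a Fin.< ι b) ×
      (∀ a b → (π ⟨ ι a ⟩ Fin.< π ⟨ ι b ⟩) ⇔ (p ⟨ a ⟩ Fin.< p ⟨ b ⟩)) →
    (∀ {a b} → a Fin.< b → κ a Fin.< κ b) ×
      (∀ a b → (π ⟨ κ a ⟩ Fin.< π ⟨ κ b ⟩) ⇔ (p ⟨ a ⟩ Fin.< p ⟨ b ⟩))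
  resp ι≗κ (mono , same) =
    (λ {a} {b} a<b → subst₂ Fin._<_ (ι≗κ a) (ι≗κ b) (mono a<b)) ,
    (λ a b → subst₂ (λ i j → (π ⟨ i ⟩ Fin.< π ⟨ j ⟩) ⇔ _) (ι≗κ a) (ι≗κ b) (same a b))

-- Searches run over codes of functions, and decoding returns a function only up to pointwise
-- equality; `resp` bridges this gap.
record DecPosition {n} (X : Position n) : Set where
  field
    dec  : ∀ π → Dec (X π)
    resp : ∀ π ρ → π ≈ ρ → X π → X ρ

Sn-dec : ∀ n → DecPosition (Sn n)
Sn-dec n = record { dec = λ _ → yes tt ; resp = λ _ _ _ _ → tt }

move-dec : ∀ {n k} {X : Position n} → DecPosition X → (p : Perm k) → DecPosition (move X p)
move-dec X? p = record
  { dec  = λ π → dec π ×-dec ¬? (contains? π p)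
  ; resp = λ π ρ π≈ρ (Xπ , π∌p) →
      resp π ρ π≈ρ Xπ , λ ρ∋p → π∌p (Contains-resp ρ π p p (sym ∘ π≈ρ) (λ _ → refl) ρ∋p)
  }
  where open DecPosition X?

injective? : ∀ {m n} (f : Fin m → Fin n) → Dec (Injective _≡_ _≡_ f)
injective? f = map′ (λ h {i} {j} → h i j) (λ h i j → h)
  (Finₚ.all? λ i → Finₚ.all? λ j → (f i Finₚ.≟ f j) →-dec (i Finₚ.≟ j))

any-perm? : ∀ {n} {P : Perm n → Set} → (∀ π ρ → π ≈ ρ → P π → P ρ) → (∀ π → Dec (P π)) → Dec (∃ P)
any-perm? {n} {P} resp P? = map′ to from (any-fun? resp′ decide)
  where
  Q : (Fin n → Fin n) → Set
  Q f = Σ (Injective _≡_ _≡_ f) λ inj → P (f , λ {i} {j} → inj {i} {j})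
  to : ∃ Q → ∃ P
  to (f , inj , h) = (f , λ {i} {j} → inj {i} {j}) , h
  from : ∃ P → ∃ Q
  from ((f , inj) , h) = f , (λ {i} {j} → inj {i} {j}) , h
  resp′ : ∀ {f g} → f ≗ g → Q f → Q g
  resp′ {f} {g} f≗g (inj , h) = (λ {i} {j} → inj′ {i} {j}) ,
    resp (f , λ {i} {j} → inj {i} {j}) (g , λ {i} {j} → inj′ {i} {j}) f≗g h
    where
    inj′ : Injective _≡_ _≡_ g
    inj′ {i} {j} eq = inj (trans (f≗g i) (trans eq (sym (f≗g j))))
  decide : ∀ f → Dec (Q f)
  decide f with injective? f
  ... | no ¬inj = no (¬inj ∘ proj₁)
  ... | yes inj = map′
    (λ h → (λ {i} {j} → inj {i} {j}) , h)
    -- Two injectivity proofs for the same `f` need not be equal, so `resp` is applied to pointwise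
    -- reflexivity.
    (λ (inj′ , h) → resp (f , λ {i} {j} → inj′ {i} {j}) (f , λ {i} {j} → inj {i} {j}) (λ _ → refl) h)
    (P? (f , λ {i} {j} → inj {i} {j}))

legal? : ∀ {n k} {X : Position n} → DecPosition X → (p : Perm k) → Dec (Legal X p)
legal? X? p = any-perm?
  (λ π ρ π≈ρ (Xπ , π∋p) → resp π ρ π≈ρ Xπ , Contains-resp π ρ p p π≈ρ (λ _ → refl) π∋p)
  (λ π → dec π ×-dec contains? π p)
  where open DecPosition X?

mex : (xs : List ℕ) → ∃ λ v → v ∉ xs × (∀ w → w < v → w ∈ xs)
-- One more than the maximum is missing from `xs`; `least` moves to a smaller missing number as long
-- as there is one.
mex xs = least (suc (max 0 xs)) (<-wellFounded _) (λ v∈ → <-irrefl refl (All.lookup (xs≤max 0 xs) v∈))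
  where
  least : ∀ v → Acc _<_ v → v ∉ xs → ∃ λ v → v ∉ xs × (∀ w → w < v → w ∈ xs)
  least v (acc rec) v∉ with anyUpTo? (λ w → ¬? (w ∈? xs)) v
  ... | yes (w , w<v , w∉) = least w (rec w<v) w∉
  ... | no none = v , v∉ , λ w w<v → decidable-stable (w ∈? xs) (λ w∉ → none (w , w<v , w∉))

SG-exists : ∀ {n k} {X : Position n} → Terminates k X → DecPosition X → ∃ λ v → SG k X v
SG-exists {n} {k} {X} (terminates rec) X? = v , sg v f (λ p l → proj₂ (option p l)) misses hits
  where
  option : ∀ p (l : Legal X p) → ∃ λ v → SG k (move X p) v
  option p l = SG-exists (rec p l) (move-dec X? p)
  f : ∀ p → Legal X p → ℕ
  f p l = proj₁ (option p l)
  codes : List (Fin (k ^ k))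
  codes = allFin _
  Option : ℕ → Set
  Option w = ∃ λ p → Σ (Legal X p) λ l → f p l ≡ w
  -- Only finitely many patterns differ up to ≈, and the value of an option does not depend on the
  -- representative or on the legality proof; so the values of the options form a list.
  values : (cs : List (Fin (k ^ k))) → ∃ λ (vs : List ℕ) → (∀ {w} → w ∈ vs → Option w) ×
    (∀ p l → funToFin (proj₁ p) ∈ cs → f p l ∈ vs)
  values [] = [] , (λ ()) , λ p l ()
  values (c ∷ cs) with values cs | injective? (finToFun c)
  ... | vs , sound , complete | no ¬inj = vs , sound , λ
    { p l (here refl) → ⊥-elim (¬inj λ {i} {j} eq → proj₂ p
        (trans (sym (finToFun-funToFin (proj₁ p) i)) (trans eq (finToFun-funToFin (proj₁ p) j))))
    ; p l (there c∈) → complete p l c∈ }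
  ... | vs , sound , complete | yes inj with legal? X? (finToFun c , inj)
  ... | no ¬l = vs , sound , λ
    { p (π , Xπ , π∋p) (here refl) → ⊥-elim (¬l (π , Xπ ,
        Contains-resp π π p (finToFun c , inj) (λ _ → refl) (sym ∘ finToFun-funToFin (proj₁ p)) π∋p))
    ; p l (there c∈) → complete p l c∈ }
  ... | yes l₀ = f q l₀ ∷ vs , (λ { (here refl) → q , l₀ , refl ; (there w∈) → sound w∈ }) , λ
    { p l (here refl) → here (SG-unique (moved p (finToFun-funToFin (proj₁ p)))
                                (proj₂ (option p l)) (proj₂ (option q l₀)))
    ; p l (there c∈) → there (complete p l c∈) }
    where
    q : Perm k
    q = finToFun c , inj
    moved : ∀ p → q ≈ p → ∀ π → move X p π ⇔ move X q π
    moved p q≈p π = mk⇔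
      (Product.map₂ λ π∌p π∋q → π∌p (Contains-resp π π q p (λ _ → refl) q≈p π∋q))
      (Product.map₂ λ π∌q π∋p → π∌q (Contains-resp π π p q (λ _ → refl) (sym ∘ q≈p) π∋p))
  vs = proj₁ (values codes)
  v = proj₁ (mex vs)
  misses : ∀ p l → f p l ≢ v
  misses p l eq = proj₁ (proj₂ (mex vs))
    (subst (_∈ vs) eq (proj₂ (proj₂ (values codes)) p l (∈-allFin _)))
  hits : ∀ w → w < v → Option w
  hits w w<v = proj₁ (proj₂ (values codes)) (proj₂ (proj₂ (mex vs)) w w<v)

-- Standardisation and subsequences

-- Sequences of distinct numbers are order-isomorphic iff they have the same standardisation; a code is
-- the standardisation of a pattern, with entries counted from 0.
Code : Set
Code = List ℕ

below : ℕ → List ℕ → ℕ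
below x [] = 0
below x (y ∷ ys) = if y <ᵇ x then suc (below x ys) else below x ys

std : List ℕ → Code
std xs = map (λ x → below x xs) xs

choose : ∀ {A : Set} → ℕ → List A → List (List A)
choose zero _ = [] ∷ []
choose (suc k) [] = []
choose (suc k) (x ∷ xs) = map (x ∷_) (choose k xs) ++ choose (suc k) xs

patterns : List ℕ → List Code
patterns xs = map std (choose 4 xs)

insertions : ∀ {A : Set} → A → List A → List (List A)
insertions u [] = (u ∷ []) ∷ []
insertions u (x ∷ xs) = (u ∷ x ∷ xs) ∷ map (x ∷_) (insertions u xs)

bump : ℕ → ℕ → ℕ
bump b x = if x <ᵇ b then x else suc x

-- Here `b` is the rank of the new entry; `bump` makes room for it. These are the standardisations
-- that one more distinct entry can produce, see `std-insertions`.
extensions : List ℕ → List (List ℕ)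
extensions xs = concatMap (λ b → insertions b (map (bump b) xs)) (upTo (suc (length xs)))

infix 4 _==_
-- Boolean tests without proof terms, because the search is evaluated during type checking.
_==_ : Code → Code → Bool
[] == [] = true
(x ∷ xs) == (y ∷ ys) = if x ≡ᵇ y then xs == ys else false
_ == _ = false

elem : Code → List Code → Bool
elem c [] = false
elem c (d ∷ ds) = if c == d then true else elem c ds

nub : List Code → List Code
nub [] = []
-- Passing `nub cs` as an argument lets evaluation share it between its two uses.
nub (c ∷ cs) = add (nub cs)
  where
  add : List Code → List Code
  add ds = if elem c ds then ds else c ∷ ds

perms : ℕ → List (List ℕ)
perms zero = [] ∷ []
perms (suc m) = nub (concatMap extensions (perms m))

-- Properties of ranks, standardisations and insertions

<ᵇ-true : ∀ {m n} → m < n → (m <ᵇ n) ≡ true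
<ᵇ-true {m} {n} = dec-true (m <? n)

<ᵇ-false : ∀ {m n} → n ≤ m → (m <ᵇ n) ≡ false
<ᵇ-false {m} {n} n≤m = dec-false (m <? n) (≤⇒≯ n≤m)

<ᵇ-reflects : ∀ {m n} → (m <ᵇ n) ≡ true → m < n
<ᵇ-reflects {m} {n} eq = <ᵇ⇒< m n (subst T (sym eq) tt)

below-≤-length : ∀ x ys → below x ys ≤ length ys
below-≤-length x [] = z≤n
below-≤-length x (y ∷ ys) with y <ᵇ x
... | true = s≤s (below-≤-length x ys)
... | false = m≤n⇒m≤1+n (below-≤-length x ys)

below-mono-≤ : ∀ {x u} ys → x ≤ u → below x ys ≤ below u ys
below-mono-≤ [] x≤u = z≤n
below-mono-≤ {x} {u} (y ∷ ys) x≤u with <-≤-connex y x | <-≤-connex y u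
... | inj₁ y<x | _ rewrite <ᵇ-true y<x | <ᵇ-true (<-≤-trans y<x x≤u) = s≤s (below-mono-≤ ys x≤u)
... | inj₂ x≤y | inj₁ y<u rewrite <ᵇ-false x≤y | <ᵇ-true y<u = m≤n⇒m≤1+n (below-mono-≤ ys x≤u)
... | inj₂ x≤y | inj₂ u≤y rewrite <ᵇ-false x≤y | <ᵇ-false u≤y = below-mono-≤ ys x≤u

-- The entry `x` itself is counted for `u` but not for `x`.
below-mono-< : ∀ {x u ys} → x ∈ ys → x < u → below x ys < below u ys
below-mono-< {x} {u} {x ∷ ys} (here refl) x<u
  rewrite <ᵇ-false (≤-refl {x}) | <ᵇ-true x<u = s≤s (below-mono-≤ ys (<⇒≤ x<u))
below-mono-< {x} {u} {y ∷ ys} (there x∈ys) x<u with <-≤-connex y x | <-≤-connex y u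
... | inj₁ y<x | _ rewrite <ᵇ-true y<x | <ᵇ-true (<-trans y<x x<u) = s≤s (below-mono-< x∈ys x<u)
... | inj₂ x≤y | inj₁ y<u rewrite <ᵇ-false x≤y | <ᵇ-true y<u = m≤n⇒m≤1+n (below-mono-< x∈ys x<u)
... | inj₂ x≤y | inj₂ u≤y rewrite <ᵇ-false x≤y | <ᵇ-false u≤y = below-mono-< x∈ys x<u

below-<-length : ∀ {x ys} → x ∈ ys → below x ys < length ys
below-<-length {x} {ys} x∈ys = <-≤-trans (below-mono-< x∈ys (n<1+n x)) (below-≤-length (suc x) ys)

below-<ᵇ : ∀ {x u ys} → x ∈ ys → (below x ys <ᵇ below u ys) ≡ (x <ᵇ u)
below-<ᵇ {x} {u} {ys} x∈ys with <-≤-connex x u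
... | inj₁ x<u = trans (<ᵇ-true (below-mono-< x∈ys x<u)) (sym (<ᵇ-true x<u))
... | inj₂ u≤x = trans (<ᵇ-false (below-mono-≤ ys u≤x)) (sym (<ᵇ-false u≤x))

map-≡⇒≡ : ∀ {A B : Set} {f g : A → B} {xs} → map f xs ≡ map g xs → ∀ {x} → x ∈ xs → f x ≡ g x
map-≡⇒≡ {xs = x ∷ xs} eq (here refl) = ∷-injectiveˡ eq
map-≡⇒≡ {xs = x ∷ xs} eq (there x∈xs) = map-≡⇒≡ (∷-injectiveʳ eq) x∈xs

SameOrder : ∀ {A : Set} → (f g : A → ℕ) → List A → Set
SameOrder f g xs = ∀ {x y} → x ∈ xs → y ∈ xs → (f x <ᵇ f y) ≡ (g x <ᵇ g y)

below-map-cong : ∀ {A : Set} (f g : A → ℕ) u xs → (∀ {x} → x ∈ xs → (f x <ᵇ f u) ≡ (g x <ᵇ g u)) →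
  below (f u) (map f xs) ≡ below (g u) (map g xs)
below-map-cong f g u [] same = refl
below-map-cong f g u (x ∷ xs) same
  rewrite same (here refl) | below-map-cong f g u xs (same ∘ there) = refl

std-map : ∀ {A : Set} (f : A → ℕ) xs → std (map f xs) ≡ map (λ x → below (f x) (map f xs)) xs
std-map f xs = sym (map-∘ xs)

std-cong : ∀ {A : Set} {f g : A → ℕ} xs → SameOrder f g xs → std (map f xs) ≡ std (map g xs)
std-cong {f = f} {g} xs same = begin
  std (map f xs)                        ≡⟨ std-map f xs ⟩
  map (λ x → below (f x) (map f xs)) xs
    ≡⟨ map-cong-local (All.tabulate λ {x} x∈xs → below-map-cong f g x xs (λ y∈xs → same y∈xs x∈xs)) ⟩
  map (λ x → below (g x) (map g xs)) xs ≡⟨ sym (std-map g xs) ⟩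
  std (map g xs)                        ∎
  where open ≡-Reasoning

-- Equal standardisations mean equal ranks entry by entry, and ranks of entries compare as the
-- entries do.
std-reflects : ∀ {A : Set} {f g : A → ℕ} xs → std (map f xs) ≡ std (map g xs) → SameOrder f g xs
std-reflects {f = f} {g} xs eq {x} {y} x∈xs y∈xs = begin
  f x <ᵇ f y                                         ≡⟨ sym (below-<ᵇ (∈-map⁺ f x∈xs)) ⟩
  below (f x) (map f xs) <ᵇ below (f y) (map f xs)   ≡⟨ cong₂ _<ᵇ_ (ranks x∈xs) (ranks y∈xs) ⟩
  below (g x) (map g xs) <ᵇ below (g y) (map g xs)   ≡⟨ below-<ᵇ (∈-map⁺ g x∈xs) ⟩
  g x <ᵇ g y                                         ∎
  where
  open ≡-Reasoning
  ranks : ∀ {x} → x ∈ xs → below (f x) (map f xs) ≡ below (g x) (map g xs)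
  ranks = map-≡⇒≡ (trans (sym (std-map f xs)) (trans eq (std-map g xs)))

⊆-map⁻ : ∀ {A B : Set} (f : A → B) {zs} ys → zs ⊆ map f ys → ∃ λ ws → ws ⊆ ys × zs ≡ map f ws
⊆-map⁻ f [] [] = [] , [] , refl
⊆-map⁻ f (y ∷ ys) (._ ∷ʳ τ) with ⊆-map⁻ f ys τ
... | ws , σ , eq = ws , y ∷ʳ σ , eq
⊆-map⁻ f (y ∷ ys) (refl ∷ τ) with ⊆-map⁻ f ys τ
... | ws , σ , eq = y ∷ ws , refl ∷ σ , cong (f y ∷_) eq

-- The search sees only `std ys`; this turns a pattern found there back into a pattern of `ys`.
std-⊆ : ∀ {zs ys} → zs ⊆ std ys → ∃ λ ws → ws ⊆ ys × length ws ≡ length zs × std ws ≡ std zs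
std-⊆ {zs} {ys} τ with ⊆-map⁻ _ ys τ
... | ws , ws⊆ys , refl =
  ws , ws⊆ys , sym (length-map _ ws) ,
  trans (cong std (sym (map-id ws)))
        (std-cong ws (λ x∈ws y∈ws → sym (below-<ᵇ (Any-resp-⊆ ws⊆ys x∈ws))))

unique-⊆ : ∀ {A : Set} {ys xs : List A} → ys ⊆ xs → Unique xs → Unique ys
unique-⊆ [] [] = []
unique-⊆ (y ∷ʳ τ) (_ ∷ uq) = unique-⊆ τ uq
unique-⊆ (refl ∷ τ) (x∉ ∷ uq) = All-resp-⊆ τ x∉ ∷ unique-⊆ τ uq

choose-⊆ : ∀ {A : Set} k {zs : List A} xs → zs ∈ choose k xs → zs ⊆ xs × length zs ≡ k
choose-⊆ zero xs (here refl) = minimum xs , refl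
choose-⊆ (suc k) (x ∷ xs) zs∈ with ∈-++⁻ (map (x ∷_) (choose k xs)) zs∈
... | inj₂ zs∈ʳ = Product.map₁ (x ∷ʳ_) (choose-⊆ (suc k) xs zs∈ʳ)
... | inj₁ zs∈ˡ with ∈-map⁻ (x ∷_) zs∈ˡ
... | ws , ws∈ , refl = Product.map (refl ∷_) (cong suc) (choose-⊆ k xs ws∈)

-- The first entry of `xs` that `ys` skips can be inserted at its place.
extend : ∀ {A : Set} {ys xs : List A} → ys ⊆ xs → length ys < length xs →
  ∃₂ λ u zs → zs ∈ insertions u ys × zs ⊆ xs
extend {ys = []} (x ∷ʳ τ) lt = x , _ , here refl , refl ∷ minimum _
extend {ys = y ∷ ys} (x ∷ʳ τ) lt = x , _ , here refl , refl ∷ τ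
extend {ys = y ∷ ys} (refl ∷ τ) (s≤s lt) with extend τ lt
... | u , zs , zs∈ , σ = u , y ∷ zs , there (∈-map⁺ (y ∷_) zs∈) , refl ∷ σ

length-insertions : ∀ {A : Set} {u : A} ys {zs} → zs ∈ insertions u ys → length zs ≡ suc (length ys)
length-insertions [] (here refl) = refl
length-insertions (y ∷ ys) (here refl) = refl
length-insertions (y ∷ ys) (there zs∈) with ∈-map⁻ (y ∷_) zs∈
... | ws , ws∈ , refl = cong suc (length-insertions ys ws∈)

map-insertions : ∀ {A B : Set} (f : A → B) {u} ys {zs} → zs ∈ insertions u ys →
  map f zs ∈ insertions (f u) (map f ys)
map-insertions f [] (here refl) = here refl
map-insertions f (y ∷ ys) (here refl) = here refl
map-insertions f (y ∷ ys) (there zs∈) with ∈-map⁻ (y ∷_) zs∈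
... | ws , ws∈ , refl = there (∈-map⁺ (f y ∷_) (map-insertions f ys ws∈))

below-swap : ∀ x a b zs → below x (a ∷ b ∷ zs) ≡ below x (b ∷ a ∷ zs)
below-swap x a b zs with a <ᵇ x | b <ᵇ x
... | true | true = refl
... | true | false = refl
... | false | true = refl
... | false | false = refl

below-insertions : ∀ x {u} ys {zs} → zs ∈ insertions u ys → below x zs ≡ below x (u ∷ ys)
below-insertions x [] (here refl) = refl
below-insertions x (y ∷ ys) (here refl) = refl
below-insertions x {u} (y ∷ ys) (there zs∈) with ∈-map⁻ (y ∷_) zs∈
... | ws , ws∈ , refl =
  trans (cong (λ r → if y <ᵇ x then suc r else r) (below-insertions x ys ws∈)) (below-swap x y u ys)

insertions-fresh : ∀ {A : Set} {u : A} ys {zs} → zs ∈ insertions u ys → Unique zs →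
  All (u ≢_) ys
insertions-fresh [] zs∈ uq = []
insertions-fresh (y ∷ ys) (here refl) (u∉ ∷ _) = u∉
insertions-fresh (y ∷ ys) (there zs∈) uq with ∈-map⁻ (y ∷_) zs∈
insertions-fresh {u = u} (y ∷ ys) (there zs∈) (y∉ ∷ uq) | ws , ws∈ , refl =
  (λ u≡y → All.lookup y∉ (u∈ ys ws∈) (sym u≡y)) ∷ insertions-fresh ys ws∈ uq
  where
  u∈ : ∀ ys {zs} → zs ∈ insertions u ys → u ∈ zs
  u∈ [] (here refl) = here refl
  u∈ (y ∷ ys) (here refl) = here refl
  u∈ (y ∷ ys) (there zs∈) with ∈-map⁻ (y ∷_) zs∈
  ... | ws , ws∈ , refl = there (u∈ ys ws∈)

-- Inserting `u` raises by one the ranks of exactly the entries above `u`, which is `bump` at the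
-- rank of `u`. Distinctness rules out an entry equal to `u`.
std-insertions : ∀ {u} ys {zs} → zs ∈ insertions u ys → Unique zs → std zs ∈ extensions (std ys)
std-insertions {u} ys {zs} zs∈ uq =
  ∈-concatMap⁺ _ {xs = upTo (suc (length (std ys)))}
    (lose (∈-upTo⁺ b<) (subst₂ (λ v vs → v ∈ insertions b vs) (sym lhs) rhs shifted))
  where
  b = below u ys
  f : ℕ → ℕ
  f x = below x (u ∷ ys)
  b< : b < suc (length (std ys))
  b< rewrite length-map (λ x → below x ys) ys = s≤s (below-≤-length u ys)
  fu : f u ≡ b
  fu rewrite <ᵇ-false (≤-refl {u}) = refl
  shifted : map f zs ∈ insertions b (map f ys)
  shifted = subst (λ c → map f zs ∈ insertions c (map f ys)) fu (map-insertions f ys zs∈)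
  lhs : std zs ≡ map f zs
  lhs = map-cong (λ x → below-insertions x ys zs∈) zs
  bumped : ∀ {x} → x ∈ ys → f x ≡ bump b (below x ys)
  bumped {x} x∈ with <-≤-connex x u
  ... | inj₁ x<u rewrite below-<ᵇ {u = u} x∈ | <ᵇ-true x<u | <ᵇ-false (<⇒≤ x<u) = refl
  ... | inj₂ u≤x rewrite below-<ᵇ {u = u} x∈ | <ᵇ-false u≤x
                       | <ᵇ-true (≤∧≢⇒< u≤x (All.lookup (insertions-fresh ys zs∈ uq) x∈)) = refl
  rhs : map f ys ≡ map (bump b) (std ys)
  rhs = trans (map-cong-local (All.tabulate bumped)) (map-∘ ys)

==-sound : ∀ c d → (c == d) ≡ true → c ≡ d
==-sound [] [] eq = refl
==-sound (x ∷ xs) (y ∷ ys) eq with x ≡ᵇ y in x≡y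
... | true = cong₂ _∷_ (≡ᵇ⇒≡ x y (subst T (sym x≡y) tt)) (==-sound xs ys eq)

==-refl : ∀ c → (c == c) ≡ true
==-refl [] = refl
==-refl (x ∷ xs) with x ≡ᵇ x | ≡⇒≡ᵇ x x refl
... | true | _ = ==-refl xs

elem-sound : ∀ {c} ds → elem c ds ≡ true → c ∈ ds
elem-sound {c} (d ∷ ds) eq with c == d in c≡d
... | true = here (==-sound c d c≡d)
... | false = there (elem-sound ds eq)

elem-complete : ∀ {c ds} → c ∈ ds → elem c ds ≡ true
elem-complete {c} (here refl) rewrite ==-refl c = refl
elem-complete {c} {d ∷ ds} (there c∈) with c == d
... | true = refl
... | false = elem-complete c∈

∈-nub⁻ : ∀ {c} cs → c ∈ nub cs → c ∈ cs
∈-nub⁻ (d ∷ cs) c∈ with elem d (nub cs)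
... | true = there (∈-nub⁻ cs c∈)
∈-nub⁻ (d ∷ cs) (here refl) | false = here refl
∈-nub⁻ (d ∷ cs) (there c∈) | false = there (∈-nub⁻ cs c∈)

∈-nub⁺ : ∀ {c cs} → c ∈ cs → c ∈ nub cs
∈-nub⁺ {c} {d ∷ cs} c∈ with elem d (nub cs) in eq
∈-nub⁺ (here refl) | true = elem-sound _ eq
∈-nub⁺ (there c∈) | true = ∈-nub⁺ c∈
∈-nub⁺ (here refl) | false = here refl
∈-nub⁺ (there c∈) | false = there (∈-nub⁺ c∈)

std-perms : ∀ ys → Unique ys → std ys ∈ perms (length ys)
std-perms [] [] = here refl
std-perms (y ∷ ys) uq@(_ ∷ uq′) =
  ∈-nub⁺ (∈-concatMap⁺ extensions (lose (std-perms ys uq′) (std-insertions ys (∷∈ ys) uq)))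
  where
  ∷∈ : ∀ ys → (y ∷ ys) ∈ insertions y ys
  ∷∈ [] = here refl
  ∷∈ (_ ∷ _) = here refl

-- Inflations

-- The inflations of the permutation `word` (entries counted from 0) in which the entry at position
-- `block` becomes an increasing or decreasing run of arbitrary length.
record Family : Set where
  constructor family
  field
    word : List ℕ
    block : ℕ
    inc : Bool

-- The junk value 0 out of range is harmless: `at word` is only used below `length word`.
at : List ℕ → ℕ → ℕ
at [] _ = 0
at (x ∷ xs) zero = x
at (x ∷ xs) (suc i) = at xs i

-- WeaklyIncreasing increasing t-tuples in lo, …, lo + m - 1 in which only r may be repeated.
blocks : (t m lo r : ℕ) → List (Vec ℕ t)
blocks zero m lo r = [] ∷ []
blocks (suc t) zero lo r = []
blocks (suc t) (suc m) lo r =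
  map (lo ∷_) (if lo ≡ᵇ r then blocks t (suc m) lo r else blocks t m (suc lo) r)
    ++ blocks (suc t) m (suc lo) r

orient : Bool → ℕ → ℕ → ℕ
orient true n i = i
orient false n i = n ∸ suc i

-- The position i of an inflation lies in block b; keys below n compare lexicographically.
key : Family → ℕ → ℕ → ℕ → ℕ
key F n b i = at (Family.word F) b * n + orient (Family.inc F) n i

-- The index `t < 4` stands in for the actual position: inside a block only the order of positions
-- matters, so base 4 is large enough.
blockCode : Family → (Fin 4 → ℕ) → Code
blockCode F b = std (tabulate (λ t → key F 4 (b t) (toℕ t)))

-- `Realise` shows that these are exactly the codes of length 4 occurring in the inflation, for
-- every run of at least 4 entries.
familyCodes : Family → List Code
familyCodes F = map (λ b → blockCode F (Vec.lookup b)) (blocks 4 (length (Family.word F)) 0 (Family.block F))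

StrictMono : ∀ {k n} → (Fin k → Fin n) → Set
StrictMono ι = ∀ {s t} → s Fin.< t → ι s Fin.< ι t

tabulate-std-cong : ∀ {k} (f g : Fin k → ℕ) → (∀ s t → (f s <ᵇ f t) ≡ (g s <ᵇ g t)) →
  std (tabulate f) ≡ std (tabulate g)
tabulate-std-cong f g same = begin
  std (tabulate f)        ≡⟨ cong std (sym (map-tabulate id f)) ⟩
  std (map f (allFin _))  ≡⟨ std-cong (allFin _) (λ {s} {t} _ _ → same s t) ⟩
  std (map g (allFin _))  ≡⟨ cong std (map-tabulate id g) ⟩
  std (tabulate g)        ∎
  where open ≡-Reasoning

tabulate-std-reflects : ∀ {k} (f g : Fin k → ℕ) → std (tabulate f) ≡ std (tabulate g) →
  ∀ s t → (f s <ᵇ f t) ≡ (g s <ᵇ g t)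
tabulate-std-reflects f g eq s t = std-reflects (allFin _)
  (trans (cong std (map-tabulate id f)) (trans eq (cong std (sym (map-tabulate id g)))))
  (∈-allFin s) (∈-allFin t)

mono-<ᵇ : ∀ {k n} {ι : Fin k → Fin n} → StrictMono ι →
  ∀ s t → (toℕ (ι s) <ᵇ toℕ (ι t)) ≡ (toℕ s <ᵇ toℕ t)
mono-<ᵇ {ι = ι} mono s t with Finₚ.<-cmp s t
... | tri< s<t _ _ = trans (<ᵇ-true (mono s<t)) (sym (<ᵇ-true s<t))
... | tri≈ _ refl _ = trans (<ᵇ-false (≤-refl {toℕ (ι s)})) (sym (<ᵇ-false (≤-refl {toℕ s})))
... | tri> _ _ t<s = trans (<ᵇ-false (<⇒≤ (mono t<s))) (sym (<ᵇ-false (<⇒≤ t<s)))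

standardise : ∀ {n} (f : Fin n → ℕ) → (∀ {i j} → f i ≡ f j → i ≡ j) →
  Σ (Perm n) λ π → ∀ i j → (toℕ (π ⟨ i ⟩) <ᵇ toℕ (π ⟨ j ⟩)) ≡ (f i <ᵇ f j)
standardise {n} f inj = (g , λ {i} {j} → g-inj i j) , same
  where
  fs : List ℕ
  fs = map f (allFin n)
  f∈ : ∀ i → f i ∈ fs
  f∈ i = ∈-map⁺ f (∈-allFin i)
  rank< : ∀ i → below (f i) fs < n
  rank< i = subst (below (f i) fs <_) (trans (length-map f (allFin n)) (length-tabulate id))
                  (below-<-length (f∈ i))
  g : Fin n → Fin n
  g i = fromℕ< (rank< i)
  same : ∀ i j → (toℕ (g i) <ᵇ toℕ (g j)) ≡ (f i <ᵇ f j)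
  same i j rewrite toℕ-fromℕ< (rank< i) | toℕ-fromℕ< (rank< j) = below-<ᵇ (f∈ i)
  g-inj : ∀ i j → g i ≡ g j → i ≡ j
  g-inj i j eq with <-cmp (f i) (f j)
  ... | tri≈ _ fi≡fj _ = inj fi≡fj
  ... | tri< fi<fj _ _ = ⊥-elim (<-irrefl (cong toℕ eq) (<ᵇ-reflects (trans (same i j) (<ᵇ-true fi<fj))))
  ... | tri> _ _ fj<fi = ⊥-elim (<-irrefl (cong toℕ (sym eq)) (<ᵇ-reflects (trans (same j i) (<ᵇ-true fj<fi))))

lex-< : ∀ {u u′ x x′ n} → u < u′ → x < n → u * n + x < u′ * n + x′
lex-< {u} {u′} {x} {x′} {n} u<u′ x<n = begin-strict
  u * n + x    <⟨ +-monoʳ-< (u * n) x<n ⟩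
  u * n + n    ≡⟨ +-comm (u * n) n ⟩
  suc u * n    ≤⟨ *-monoˡ-≤ n u<u′ ⟩
  u′ * n       ≤⟨ m≤m+n (u′ * n) x′ ⟩
  u′ * n + x′  ∎
  where open ≤-Reasoning

+-<ᵇ : ∀ a {x y} → (a + x <ᵇ a + y) ≡ (x <ᵇ y)
+-<ᵇ zero = refl
+-<ᵇ (suc a) = +-<ᵇ a

-- With `x < n`, the number `u * n + x` encodes the pair `(u , x)` in lexicographic order, so the
-- base can be changed as long as the second components keep their order.
lex-cong : ∀ {u u′ x x′ n y y′ m} → x < n → x′ < n → y < m → y′ < m →
  (x <ᵇ x′) ≡ (y <ᵇ y′) → (u * n + x <ᵇ u′ * n + x′) ≡ (u * m + y <ᵇ u′ * m + y′)
lex-cong {u} {u′} {n = n} {m = m} x< x′< y< y′< same with <-cmp u u′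
... | tri< u<u′ _ _ = trans (<ᵇ-true (lex-< u<u′ x<)) (sym (<ᵇ-true (lex-< u<u′ y<)))
... | tri≈ _ refl _ = trans (+-<ᵇ (u * n)) (trans same (sym (+-<ᵇ (u * m))))
... | tri> _ _ u′<u = trans (<ᵇ-false (<⇒≤ (lex-< u′<u x′<))) (sym (<ᵇ-false (<⇒≤ (lex-< u′<u y′<))))

lex-injective : ∀ {u u′ x x′ n} → x < n → x′ < n → u * n + x ≡ u′ * n + x′ → x ≡ x′
lex-injective {u} {u′} {n = n} x< x′< eq with <-cmp u u′
... | tri< u<u′ _ _ = ⊥-elim (<-irrefl eq (lex-< u<u′ x<))
... | tri≈ _ refl _ = +-cancelˡ-≡ (u * n) _ _ eq
... | tri> _ _ u′<u = ⊥-elim (<-irrefl (sym eq) (lex-< u′<u x′<))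

orient-< : ∀ d {n i} → i < n → orient d n i < n
orient-< true i<n = i<n
orient-< false {suc n} {i} (s≤s i≤n) = s≤s (m∸n≤m n i)

orient-injective : ∀ d {n i j} → i < n → j < n → orient d n i ≡ orient d n j → i ≡ j
orient-injective true _ _ eq = eq
orient-injective false i<n j<n eq = suc-injective (∸-cancelˡ-≡ i<n j<n eq)

orient-false-<ᵇ : ∀ {n i j} → i < n → (orient false n i <ᵇ orient false n j) ≡ (j <ᵇ i)
orient-false-<ᵇ {n} {i} {j} i<n with <-≤-connex j i
... | inj₁ j<i = trans (<ᵇ-true (∸-monoʳ-< (s≤s j<i) i<n)) (sym (<ᵇ-true j<i))
... | inj₂ i≤j = trans (<ᵇ-false (∸-monoʳ-≤ n (s≤s i≤j))) (sym (<ᵇ-false i≤j))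

orient-cong : ∀ d {n i j m s t} → i < n → s < m → (i <ᵇ j) ≡ (s <ᵇ t) → (j <ᵇ i) ≡ (t <ᵇ s) →
  (orient d n i <ᵇ orient d n j) ≡ (orient d m s <ᵇ orient d m t)
orient-cong true _ _ same _ = same
orient-cong false i<n s<m _ same = trans (orient-false-<ᵇ i<n) (trans same (sym (orient-false-<ᵇ s<m)))

WeaklyIncreasing : ∀ {t} → ℕ → (Fin t → ℕ) → Set
WeaklyIncreasing r b = ∀ {s s′} → s Fin.< s′ → b s < b s′ ⊎ (b s ≡ r × b s′ ≡ r)

-- The branches of `blocks` record whether the first entry is `lo`. After taking `lo` the lower
-- bound stays put if `lo` is `r`, and rises otherwise.
∈-blocks⁺ : ∀ t m lo r (b : Fin t → ℕ) → WeaklyIncreasing r b → (∀ s → lo ≤ b s) → (∀ s → b s < lo + m) →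
  Vec.tabulate b ∈ blocks t m lo r
∈-blocks⁺ zero m lo r b weak lower upper = here refl
∈-blocks⁺ (suc t) zero lo r b weak lower upper =
  ⊥-elim (<⇒≱ (upper zero) (subst (_≤ b zero) (sym (+-identityʳ lo)) (lower zero)))
∈-blocks⁺ (suc t) (suc m) lo r b weak lower upper with <-cmp lo (b zero)
... | tri> _ _ b<lo = ⊥-elim (<⇒≱ b<lo (lower zero))
... | tri< lo<b _ _ = ∈-++⁺ʳ _ (∈-blocks⁺ (suc t) m (suc lo) r b weak lower′
                        (λ s → subst (b s <_) (+-suc lo m) (upper s)))
  where
  lower′ : ∀ s → suc lo ≤ b s
  lower′ zero = lo<b
  lower′ (suc s) with weak {zero} {suc s} z<s
  ... | inj₁ b< = <-trans lo<b b<
  ... | inj₂ (b₀ , bₛ) = subst (lo <_) (trans b₀ (sym bₛ)) lo<b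
... | tri≈ _ refl _ = ∈-++⁺ˡ (∈-map⁺ (lo ∷_) tail∈)
  where
  tail∈ : Vec.tabulate (b ∘ suc) ∈ (if lo ≡ᵇ r then blocks t (suc m) lo r else blocks t m (suc lo) r)
  tail∈ with lo ≡ᵇ r in lo≡r
  ... | true = ∈-blocks⁺ t (suc m) lo r (b ∘ suc) (weak ∘ s≤s) (lower ∘ suc) (upper ∘ suc)
  ... | false = ∈-blocks⁺ t m (suc lo) r (b ∘ suc) (weak ∘ s≤s) lower′
                  (λ s → subst (b (suc s) <_) (+-suc lo m) (upper (suc s)))
    where
    lower′ : ∀ s → suc lo ≤ b (suc s)
    lower′ s with weak {zero} {suc s} z<s
    ... | inj₁ b< = b<
    ... | inj₂ (b₀ , _) = ⊥-elim (subst T lo≡r (≡⇒≡ᵇ lo r b₀))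

∈-blocks⁻ : ∀ t m lo r {b} → b ∈ blocks t m lo r →
  (∀ s → lo ≤ Vec.lookup b s) × (∀ s → Vec.lookup b s < lo + m) × WeaklyIncreasing r (Vec.lookup b)
∈-blocks⁻ zero m lo r (here refl) = (λ ()) , (λ ()) , λ { {()} }
∈-blocks⁻ (suc t) (suc m) lo r b∈
  with ∈-++⁻ (map (lo ∷_) (if lo ≡ᵇ r then blocks t (suc m) lo r else blocks t m (suc lo) r)) b∈
... | inj₂ b∈ʳ =
  let (lower , upper , weak) = ∈-blocks⁻ (suc t) m (suc lo) r b∈ʳ
  in (λ s → <⇒≤ (lower s)) , (λ s → ≤-trans (upper s) (≤-reflexive (sym (+-suc lo m)))) , weak
... | inj₁ b∈ˡ with ∈-map⁻ (lo ∷_) b∈ˡ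
... | b , b∈′ , refl = headed b∈′
  where
  Bounds : (Fin (suc t) → ℕ) → Set
  Bounds b = (∀ s → lo ≤ b s) × (∀ s → b s < lo + suc m) × WeaklyIncreasing r b
  headed : b ∈ (if lo ≡ᵇ r then blocks t (suc m) lo r else blocks t m (suc lo) r) →
    Bounds (Vec.lookup (lo ∷ b))
  headed b∈′ with lo ≡ᵇ r in lo≡r
  ... | true =
    let (lower , upper , weak) = ∈-blocks⁻ t (suc m) lo r b∈′
        below-or-same : ∀ s → lo < Vec.lookup b s ⊎ (lo ≡ r × Vec.lookup b s ≡ r)
        below-or-same s = Sum.map₂ (λ lo≡ → r≡ , trans (sym lo≡) r≡) (m≤n⇒m<n∨m≡n (lower s))
    in (λ { zero → ≤-refl ; (suc s) → lower s }) ,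
       (λ { zero → m<m+n lo z<s ; (suc s) → upper s }) ,
       λ { {zero} {suc s} _ → below-or-same s ; {suc s} {suc s′} (s≤s s<s′) → weak s<s′ }
    where
    r≡ : lo ≡ r
    r≡ = ≡ᵇ⇒≡ lo r (subst T (sym lo≡r) tt)
  ... | false =
    let (lower , upper , weak) = ∈-blocks⁻ t m (suc lo) r b∈′
    in (λ { zero → ≤-refl ; (suc s) → <⇒≤ (lower s) }) ,
       (λ { zero → m<m+n lo z<s ; (suc s) → ≤-trans (upper s) (≤-reflexive (sym (+-suc lo m))) }) ,
       λ { {zero} {suc s} _ → inj₁ (lower s) ; {suc s} {suc s′} (s≤s s<s′) → weak s<s′ }

-- The block of position i when block r has been inflated to length e + 1 (positions r, …, r + e).
blockOf : ℕ → ℕ → ℕ → ℕ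
blockOf r e i = i ⊓ r + (i ∸ (r + e))

module _ (r e : ℕ) where

  blockOf-≤ : ∀ {i} → i ≤ r → blockOf r e i ≡ i
  blockOf-≤ {i} i≤r rewrite m≤n⇒m⊓n≡m i≤r | m≤n⇒m∸n≡0 (m≤n⇒m≤n+o e i≤r) = +-identityʳ i

  blockOf-run : ∀ {i} → r ≤ i → i ≤ r + e → blockOf r e i ≡ r
  blockOf-run {i} r≤i i≤ rewrite m≥n⇒m⊓n≡n r≤i | m≤n⇒m∸n≡0 i≤ = +-identityʳ r

  blockOf-≥ : ∀ {i} → r ≤ i → blockOf r e i ≡ r + (i ∸ (r + e))
  blockOf-≥ {i} r≤i rewrite m≥n⇒m⊓n≡n r≤i = refl

  blockOf-mono : ∀ {i j} → i ≤ j → blockOf r e i ≤ blockOf r e j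
  blockOf-mono i≤j = +-mono-≤ (⊓-monoˡ-≤ r i≤j) (∸-monoˡ-≤ (r + e) i≤j)

  blockOf-< : ∀ {i j} → i < j →
    blockOf r e i < blockOf r e j ⊎ (blockOf r e i ≡ r × blockOf r e j ≡ r)
  blockOf-< {i} {j} i<j with ≤-<-connex j (r + e)
  blockOf-< {i} {j} i<j | inj₁ j≤r+e with <-≤-connex i r
  ... | inj₂ r≤i = inj₂ (blockOf-run r≤i (≤-trans (<⇒≤ i<j) j≤r+e) ,
                         blockOf-run (≤-trans r≤i (<⇒≤ i<j)) j≤r+e)
  ... | inj₁ i<r with ≤-<-connex j r
  ... | inj₁ j≤r rewrite blockOf-≤ (<⇒≤ i<r) | blockOf-≤ j≤r = inj₁ i<j
  ... | inj₂ r<j rewrite blockOf-≤ (<⇒≤ i<r) | blockOf-run (<⇒≤ r<j) j≤r+e = inj₁ i<r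
  blockOf-< {i} {j} i<j | inj₂ r+e<j with ≤-<-connex i (r + e)
  ... | inj₁ i≤r+e = inj₁ (begin-strict
      i ⊓ r + (i ∸ (r + e))  ≡⟨ cong (i ⊓ r +_) (m≤n⇒m∸n≡0 i≤r+e) ⟩
      i ⊓ r + 0              <⟨ +-mono-≤-< (m⊓n≤n i r) (m<n⇒0<n∸m r+e<j) ⟩
      r + (j ∸ (r + e))      ≡⟨ sym (blockOf-≥ (<⇒≤ (≤-<-trans (m≤m+n r e) r+e<j))) ⟩
      blockOf r e j          ∎)
    where open ≤-Reasoning
  ... | inj₂ r+e<i rewrite blockOf-≥ (<⇒≤ (≤-<-trans (m≤m+n r e) r+e<i))
                         | blockOf-≥ (<⇒≤ (≤-<-trans (m≤m+n r e) r+e<j)) =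
      inj₁ (+-monoʳ-< r (∸-monoˡ-< i<j (<⇒≤ r+e<i)))

  blockOf-bound : ∀ {k i} → r < k → i < k + e → blockOf r e i < k
  blockOf-bound {k} {i} r<k i<k+e with ≤-<-connex i (r + e)
  ... | inj₁ i≤r+e = ≤-<-trans (≤-trans (blockOf-mono i≤r+e)
                                     (≤-reflexive (blockOf-run (m≤m+n r e) ≤-refl))) r<k
  ... | inj₂ r+e<i = +-cancelʳ-< e _ _ (begin-strict
      blockOf r e i + e          ≡⟨ cong (_+ e) (blockOf-≥ (<⇒≤ (≤-<-trans (m≤m+n r e) r+e<i))) ⟩
      r + (i ∸ (r + e)) + e      ≡⟨ +-assoc r _ e ⟩
      r + (i ∸ (r + e) + e)      ≡⟨ cong (r +_) (+-comm _ e) ⟩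
      r + (e + (i ∸ (r + e)))    ≡⟨ sym (+-assoc r e _) ⟩
      r + e + (i ∸ (r + e))      ≡⟨ m+[n∸m]≡n (<⇒≤ r+e<i) ⟩
      i                          <⟨ i<k+e ⟩
      k + e                      ∎)
    where open ≤-Reasoning

  -- Outside the run the position is determined by the block. Inside it, offset `t` is taken, so
  -- that several picks from the run come in increasing order.
  place : ∀ {k} b t → b < k → t ≤ e → ∃ λ i → i < k + e × blockOf r e i ≡ b × (b ≡ r → i ≡ r + t)
  place {k} b t b<k t≤e with <-cmp b r
  ... | tri< b<r b≢r _ = b , m≤n⇒m≤n+o e b<k , blockOf-≤ (<⇒≤ b<r) , ⊥-elim ∘ b≢r
  ... | tri≈ _ refl _ = b + t , +-mono-<-≤ b<k t≤e , blockOf-run (m≤m+n b t) (+-monoʳ-≤ b t≤e) , λ _ → refl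
  ... | tri> _ b≢r r<b = b + e , +-monoˡ-< e b<k ,
      trans (blockOf-≥ (≤-trans (<⇒≤ r<b) (m≤m+n b e)))
            (trans (cong (r +_) (trans (cong₂ _∸_ (+-comm b e) (+-comm r e)) ([m+n]∸[m+o]≡n∸o e b r)))
                   (m+[n∸m]≡n (<⇒≤ r<b))) ,
      ⊥-elim ∘ b≢r

codeAt : ∀ {n k} → Perm n → (Fin k → Fin n) → Code
codeAt π ι = std (tabulate (λ t → toℕ (π ⟨ ι t ⟩)))

-- The run has `e + 1` entries, so `3 ≤ e` leaves room for a whole pattern of length 4 inside it.
module Realise (F : Family) (e : ℕ) (3≤e : 3 ≤ e) (r<k : Family.block F < length (Family.word F)) where
  open Family F renaming (block to r; inc to d)
  k n : ℕ
  k = length word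
  n = k + e

  entry : Fin n → ℕ
  entry i = key F n (blockOf r e (toℕ i)) (toℕ i)

  entry-injective : ∀ {i j} → entry i ≡ entry j → i ≡ j
  entry-injective {i} {j} eq = toℕ-injective (orient-injective d (toℕ<n i) (toℕ<n j)
    (lex-injective {u = at word (blockOf r e (toℕ i))} {u′ = at word (blockOf r e (toℕ j))}
      (orient-< d (toℕ<n i)) (orient-< d (toℕ<n j)) eq))

  perm : Perm n
  perm = proj₁ (standardise entry entry-injective)

  -- This is why the length of the run is invisible: entries in different blocks compare by `word`,
  -- entries in the same block by position, and `ι` preserves the order of positions.
  code-blocks : ∀ (ι : Fin 4 → Fin n) (b : Fin 4 → ℕ) → StrictMono ι →
    (∀ t → blockOf r e (toℕ (ι t)) ≡ b t) → codeAt perm ι ≡ blockCode F b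
  code-blocks ι b mono blk = tabulate-std-cong
    (λ t → toℕ (perm ⟨ ι t ⟩)) (λ t → key F 4 (b t) (toℕ t)) λ s t → begin
    toℕ (perm ⟨ ι s ⟩) <ᵇ toℕ (perm ⟨ ι t ⟩)
      ≡⟨ proj₂ (standardise entry entry-injective) (ι s) (ι t) ⟩
    entry (ι s) <ᵇ entry (ι t)
      ≡⟨ cong₂ (λ u v → key F n u (toℕ (ι s)) <ᵇ key F n v (toℕ (ι t))) (blk s) (blk t) ⟩
    key F n (b s) (toℕ (ι s)) <ᵇ key F n (b t) (toℕ (ι t))
      ≡⟨ lex-cong {u = at word (b s)} {u′ = at word (b t)}
           (orient-< d (toℕ<n (ι s))) (orient-< d (toℕ<n (ι t))) (orient-< d (toℕ<n s)) (orient-< d (toℕ<n t))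
           (orient-cong d (toℕ<n (ι s)) (toℕ<n s) (mono-<ᵇ mono s t) (mono-<ᵇ mono t s)) ⟩
    key F 4 (b s) (toℕ s) <ᵇ key F 4 (b t) (toℕ t) ∎
    where open ≡-Reasoning

  blockCode-cong : ∀ {b b′ : Fin 4 → ℕ} → (∀ t → b t ≡ b′ t) → blockCode F b ≡ blockCode F b′
  blockCode-cong eq = cong std (tabulate-cong (λ t → cong (λ u → key F 4 u (toℕ t)) (eq t)))

  code∈familyCodes : ∀ {ι : Fin 4 → Fin n} → StrictMono ι → codeAt perm ι ∈ familyCodes F
  code∈familyCodes {ι} mono = subst (_∈ familyCodes F)
    (sym (trans (code-blocks ι b mono (λ _ → refl)) (blockCode-cong (λ t → sym (lookup∘tabulate b t)))))
    (∈-map⁺ (λ v → blockCode F (Vec.lookup v))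
      (∈-blocks⁺ 4 k 0 r b (λ s<t → blockOf-< r e (mono s<t)) (λ _ → z≤n)
                 (λ t → blockOf-bound r e r<k (toℕ<n (ι t)))))
    where
    b : Fin 4 → ℕ
    b t = blockOf r e (toℕ (ι t))

  blocks-occur : ∀ (v : Vec ℕ 4) → (∀ t → Vec.lookup v t < k) → WeaklyIncreasing r (Vec.lookup v) →
    ∃ λ (ι : Fin 4 → Fin n) → StrictMono ι × (∀ t → blockOf r e (toℕ (ι t)) ≡ Vec.lookup v t)
  blocks-occur v upper weak = ι , mono , ι-block
    where
    t≤e : ∀ (t : Fin 4) → toℕ t ≤ e
    t≤e t = ≤-trans (s≤s⁻¹ (toℕ<n t)) 3≤e
    spot : ∀ t → ∃ λ i → i < n × blockOf r e i ≡ Vec.lookup v t × (Vec.lookup v t ≡ r → i ≡ r + toℕ t)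
    spot t = place r e (Vec.lookup v t) (toℕ t) (upper t) (t≤e t)
    ι : Fin 4 → Fin n
    ι t = fromℕ< (proj₁ (proj₂ (spot t)))
    ι-toℕ : ∀ t → toℕ (ι t) ≡ proj₁ (spot t)
    ι-toℕ t = toℕ-fromℕ< (proj₁ (proj₂ (spot t)))
    ι-block : ∀ t → blockOf r e (toℕ (ι t)) ≡ Vec.lookup v t
    ι-block t = trans (cong (blockOf r e) (ι-toℕ t)) (proj₁ (proj₂ (proj₂ (spot t))))
    ι-run : ∀ t → Vec.lookup v t ≡ r → toℕ (ι t) ≡ r + toℕ t
    ι-run t eq = trans (ι-toℕ t) (proj₂ (proj₂ (proj₂ (spot t))) eq)
    mono : StrictMono ι
    mono {s} {t} s<t with weak s<t
    -- Distinct blocks force the order of positions by monotonicity of `blockOf`; in the run, the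
    -- offsets `s < t` do.
    ... | inj₁ b<b′ = ≰⇒> λ ιt≤ιs → <⇒≱ b<b′ (subst₂ _≤_ (ι-block t) (ι-block s) (blockOf-mono r e ιt≤ιs))
    ... | inj₂ (bs , bt) = subst₂ _<_ (sym (ι-run s bs)) (sym (ι-run t bt)) (+-monoʳ-< r s<t)

  familyCodes-occur : ∀ {c} → c ∈ familyCodes F → ∃ λ (ι : Fin 4 → Fin n) → StrictMono ι × codeAt perm ι ≡ c
  familyCodes-occur c∈ =
    let (v , v∈ , c≡) = ∈-map⁻ (λ v → blockCode F (Vec.lookup v)) c∈
        (_ , upper , weak) = ∈-blocks⁻ 4 k 0 r v∈
        (ι , mono , ι-block) = blocks-occur v upper weak
    in ι , mono , trans (code-blocks ι (Vec.lookup v) mono ι-block) (sym c≡)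

-- The search

-- Picks one of c and its reverse.
canon : Code → Code
canon (a ∷ b ∷ c ∷ d ∷ []) = if a <ᵇ d then a ∷ b ∷ c ∷ d ∷ [] else d ∷ c ∷ b ∷ a ∷ []
canon c = c

closedPatterns : List ℕ → List Code
closedPatterns xs = nub (map canon (patterns xs))

keep : List Code → List Code → List Code
keep cs = filterᵇ (λ c → not (elem c cs))

-- Each m in ms lists the codes of an inflation that are still missing.  The codes occurring in xs, and
-- their reverses, are struck off; the search succeeds if some list becomes empty in xs, or else in every
-- one-point extension of xs, up to d further points.
search descend : ℕ → List (List Code) → List ℕ → Bool
searchBelow : ℕ → List (List Code) → List ℕ → Bool
-- The shortened lists become an argument of `descend`, so they are computed once and passed on to
-- all extensions.
search d ms xs = descend d (map (keep (closedPatterns xs)) ms) xs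
descend d ms xs = any null ms ∨ searchBelow d ms xs
searchBelow zero ms xs = false
searchBelow (suc d) ms xs = all (search d ms) (nub (extensions xs))

candidates : Code → List (List Code) → List (List Code)
candidates c = filterᵇ (λ cs → not (elem c cs) ∧ elem (List.reverse c) cs)

monotoneCodes : List Code
monotoneCodes = (0 ∷ 1 ∷ 2 ∷ 3 ∷ []) ∷ (3 ∷ 2 ∷ 1 ∷ 0 ∷ []) ∷ []

prepare : List Code → List Code
prepare cs = nub (map canon (keep monotoneCodes cs))

-- c is the pattern chosen by Player I; an inflation is a candidate if it contains the reverse of c, not c.
-- Monotone codes are free by Erdős–Szekeres.
searchSucceeds : List (List Code) → Bool
searchSucceeds css = all (λ c → search 3 (map prepare (candidates c css)) c) (perms 4)

reverseF : Family → Family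
reverseF (family w r d) = family (List.reverse w) (length w ∸ suc r) (not d)

complementF : Family → Family
complementF (family w r d) = family (map (λ x → length w ∸ suc x) w) r (not d)

-- Found by computer search.
families : List Family
families =
  family (0 ∷ []) 0 true ∷
  family (1 ∷ 0 ∷ []) 0 true ∷
  family (0 ∷ 2 ∷ 1 ∷ []) 0 true ∷
  family (0 ∷ 2 ∷ 1 ∷ []) 1 true ∷
  family (0 ∷ 2 ∷ 1 ∷ []) 2 true ∷
  family (1 ∷ 2 ∷ 0 ∷ []) 2 true ∷
  family (2 ∷ 1 ∷ 0 ∷ []) 1 true ∷
  family (0 ∷ 2 ∷ 1 ∷ 3 ∷ []) 0 true ∷
  family (0 ∷ 2 ∷ 1 ∷ 3 ∷ []) 1 true ∷
  family (0 ∷ 2 ∷ 3 ∷ 1 ∷ []) 0 true ∷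
  family (0 ∷ 2 ∷ 3 ∷ 1 ∷ []) 3 true ∷
  family (0 ∷ 3 ∷ 1 ∷ 2 ∷ []) 0 true ∷
  family (0 ∷ 3 ∷ 1 ∷ 2 ∷ []) 1 true ∷
  family (1 ∷ 3 ∷ 0 ∷ 2 ∷ []) 0 true ∷
  family (1 ∷ 3 ∷ 0 ∷ 2 ∷ []) 1 true ∷
  family (1 ∷ 3 ∷ 2 ∷ 0 ∷ []) 3 true ∷
  family (2 ∷ 0 ∷ 3 ∷ 1 ∷ []) 0 true ∷
  family (2 ∷ 0 ∷ 3 ∷ 1 ∷ []) 1 true ∷
  family (2 ∷ 1 ∷ 3 ∷ 0 ∷ []) 2 true ∷
  family (0 ∷ 2 ∷ 1 ∷ 4 ∷ 3 ∷ []) 0 true ∷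
  family (0 ∷ 2 ∷ 3 ∷ 1 ∷ 4 ∷ []) 0 true ∷
  family (0 ∷ 2 ∷ 3 ∷ 1 ∷ 4 ∷ []) 4 true ∷
  family (0 ∷ 3 ∷ 1 ∷ 4 ∷ 2 ∷ []) 0 true ∷
  family (0 ∷ 3 ∷ 4 ∷ 1 ∷ 2 ∷ []) 0 true ∷
  family (1 ∷ 0 ∷ 2 ∷ 4 ∷ 3 ∷ []) 2 true ∷
  family (1 ∷ 4 ∷ 2 ∷ 0 ∷ 3 ∷ []) 0 true ∷
  family (3 ∷ 0 ∷ 2 ∷ 4 ∷ 1 ∷ []) 2 true ∷
  []

-- Symmetry only shortens the table: the search treats the resulting 108 inflations as unrelated.
allFamilies : List Family
allFamilies = fs ++ map complementF fs
  where
  fs : List Family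
  fs = families ++ map reverseF families

-- At length n ≥ 10 this leaves a run of at least 4 entries.
Fits : Family → Set
Fits F = Family.block F < length (Family.word F) × length (Family.word F) ≤ 7

families-fit : All Fits allFamilies
families-fit = toWitness {a? = All.all? (λ _ → (_ <? _) ×-dec (_ ≤? _)) allFamilies} tt

-- By evaluation: each of the 24 patterns is the root of a search through its extensions of length
-- at most 7.
search-succeeds : searchSucceeds (map familyCodes allFamilies) ≡ true
search-succeeds = refl

-- Soundness of the search

all-sound : ∀ {A : Set} {p : A → Bool} xs → all p xs ≡ true → ∀ {x} → x ∈ xs → p x ≡ true
all-sound {p = p} xs eq x∈ = Equivalence.to T-≡ (All.lookup (all⁺ p xs (Equivalence.from T-≡ eq)) x∈)

canon-cases : ∀ c → canon c ≡ c ⊎ canon c ≡ List.reverse c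
canon-cases [] = inj₁ refl
canon-cases (_ ∷ []) = inj₁ refl
canon-cases (_ ∷ _ ∷ []) = inj₁ refl
canon-cases (_ ∷ _ ∷ _ ∷ []) = inj₁ refl
canon-cases (a ∷ _ ∷ _ ∷ d ∷ []) with a <ᵇ d
... | true = inj₁ refl
... | false = inj₂ refl
canon-cases (_ ∷ _ ∷ _ ∷ _ ∷ _ ∷ _) = inj₁ refl

-- `Allowed` will be the complement of a reverse-closed set of chosen codes. Closure under reversal
-- justifies working with `canon` representatives.
module _ (Allowed : Code → Set) (allowed-reverse : ∀ {c} → Allowed c → Allowed (List.reverse c)) where

  allowed-canon : ∀ {c} → Allowed c → Allowed (canon c)
  allowed-canon {c} h with canon-cases c
  ... | inj₁ eq = subst Allowed (sym eq) h
  ... | inj₂ eq = subst Allowed (sym eq) (allowed-reverse h)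

  canon-allowed : ∀ {c} → Allowed (canon c) → Allowed c
  canon-allowed {c} h with canon-cases c
  ... | inj₁ eq = subst Allowed eq h
  ... | inj₂ eq = subst Allowed (reverse-involutive c) (allowed-reverse (subst Allowed eq h))

  keep-allowed : ∀ {cs} ds → All Allowed cs → All Allowed (keep cs ds) → All Allowed ds
  keep-allowed [] cs✓ ds✓ = []
  keep-allowed {cs} (d ∷ ds) cs✓ ds✓ with elem d cs in eq
  ... | true = All.lookup cs✓ (elem-sound cs eq) ∷ keep-allowed ds cs✓ ds✓
  keep-allowed {cs} (d ∷ ds) cs✓ (d✓ ∷ ds✓) | false = d✓ ∷ keep-allowed ds cs✓ ds✓

  module _ (xs : List ℕ) (uq : Unique xs)
           (xs✓ : ∀ {zs} → zs ⊆ xs → length zs ≡ 4 → Allowed (std zs)) where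

    closedPatterns-allowed : ∀ {ys} → ys ⊆ xs → All Allowed (closedPatterns (std ys))
    closedPatterns-allowed {ys} ys⊆xs = All.tabulate allowed
      where
      allowed : ∀ {c} → c ∈ closedPatterns (std ys) → Allowed c
      allowed c∈ with ∈-map⁻ canon (∈-nub⁻ (map canon (patterns (std ys))) c∈)
      ... | d , d∈ , refl with ∈-map⁻ std d∈
      ... | zs , zs∈ , refl with choose-⊆ 4 (std ys) zs∈
      ... | zs⊆ , len with std-⊆ zs⊆
      ... | ws , ws⊆ys , len′ , eq =
        allowed-canon (subst Allowed eq (xs✓ (⊆-trans ws⊆ys ys⊆xs) (trans len′ len)))

    -- Codes struck off at `std ys` are patterns of `xs` up to reversal, hence allowed. The search
    -- succeeds on all extensions, in particular on the one that `xs` itself provides; the length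
    -- bound guarantees that there is one at each of the `d` remaining levels.
    search-sound : ∀ d ms {ys} → ys ⊆ xs → length ys + d ≤ length xs →
      search d ms (std ys) ≡ true → ∃ λ m → m ∈ ms × All Allowed m
    descend-sound : ∀ d ms {ys} → ys ⊆ xs → length ys + d ≤ length xs →
      descend d ms (std ys) ≡ true → ∃ λ m → m ∈ ms × All Allowed m
    searchBelow-sound : ∀ d ms {ys} → ys ⊆ xs → length ys + d ≤ length xs →
      searchBelow d ms (std ys) ≡ true → ∃ λ m → m ∈ ms × All Allowed m

    search-sound d ms {ys} ys⊆xs room ok
      with descend-sound d (map (keep (closedPatterns (std ys))) ms) ys⊆xs room ok
    ... | m′ , m′∈ , m′✓ with ∈-map⁻ (keep (closedPatterns (std ys))) m′∈
    ... | m , m∈ , refl = m , m∈ , keep-allowed m (closedPatterns-allowed ys⊆xs) m′✓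

    descend-sound d ms ys⊆xs room ok with any null ms in eq
    ... | true = emptied ms eq
      where
      emptied : ∀ ms → any null ms ≡ true → ∃ λ m → m ∈ ms × All Allowed m
      emptied ([] ∷ ms) eq = [] , here refl , []
      emptied ((_ ∷ _) ∷ ms) eq with emptied ms eq
      ... | m , m∈ , m✓ = m , there m∈ , m✓
    ... | false = searchBelow-sound d ms ys⊆xs room ok

    searchBelow-sound (suc d) ms {ys} ys⊆xs room ok
      with extend ys⊆xs (<-≤-trans (m<m+n (length ys) (s≤s z≤n)) room)
    ... | u , zs , zs∈ , zs⊆xs =
      search-sound d ms zs⊆xs
        (subst (_≤ length xs)
               (trans (+-suc (length ys) d) (cong (_+ d) (sym (length-insertions ys zs∈)))) room)
        (all-sound _ ok (∈-nub⁺ (std-insertions ys zs∈ (unique-⊆ zs⊆xs uq))))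

-- Erdős–Szekeres

module Chains {n} (_∼_ : Rel (Fin n) 0ℓ) (_∼?_ : Decidable _∼_) where

  -- `k` counts steps, so `Chain 3` gives a subsequence of length 4.
  Chain : ℕ → Fin n → Set
  Chain zero i = ⊤
  Chain (suc k) i = ∃ λ j → i ∼ j × Chain k j

  chain? : ∀ k i → Dec (Chain k i)
  chain? zero i = yes tt
  chain? (suc k) i = Finₚ.any? λ j → (i ∼? j) ×-dec chain? k j

  -- Chains start at i, so i ∼ j forces i and j to have different levels.
  level : ∀ r i → ¬ Chain r i → ∃ λ k → k < r × Chain k i × ¬ Chain (suc k) i
  level zero i ¬c = contradiction tt ¬c
  level (suc r) i ¬c with chain? r i
  ... | yes c = r , n<1+n r , c , ¬c
  ... | no ¬c′ with level r i ¬c′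
  ... | k , k<r , ck , ¬ck = k , m<n⇒m<1+n k<r , ck , ¬ck

  chainPath : ∀ k {i} → Chain k i → Fin (suc k) → Fin n
  chainPath k {i} c zero = i
  chainPath (suc k) (_ , _ , c) (suc s) = chainPath k c s

  chainPath-∼ : Transitive _∼_ → ∀ k {i} (c : Chain k i) {s t} → s Fin.< t →
    chainPath k c s ∼ chainPath k c t
  chainPath-∼ tr (suc k) (_ , i∼j , c) {zero} {suc zero} _ = i∼j
  chainPath-∼ tr (suc (suc k)) (_ , i∼j , c) {zero} {suc (suc t)} _ =
    tr i∼j (chainPath-∼ tr (suc k) c {zero} {suc t} z<s)
  chainPath-∼ tr (suc k) (_ , _ , c) {suc s} {suc t} (s≤s s<t) = chainPath-∼ tr k c {s} {t} s<t

-- Label each index by the lengths of the longest chains of both kinds starting there. With fewer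
-- labels than indices two indices `i < j` share a label, but the relation between them prolongs a
-- chain at `j` to a longer one at `i`.
erdős–szekeres : ∀ {n r s} {_∼_ _≁_ : Rel (Fin n) 0ℓ} (∼? : Decidable _∼_) (≁? : Decidable _≁_) →
  (∀ {i j} → i Fin.< j → i ∼ j ⊎ i ≁ j) → r * s < n →
  (∀ i → ¬ Chains.Chain _∼_ ∼? r i) → ¬ (∀ i → ¬ Chains.Chain _≁_ ≁? s i)
erdős–szekeres {n} {r} {s} {_∼_} {_≁_} ∼? ≁? total rs<n ¬∼ ¬≁ = collide (pigeonhole rs<n pair)
  where
  module A = Chains _∼_ ∼?
  module B = Chains _≁_ ≁?
  a : ∀ i → ∃ λ k → k < r × A.Chain k i × ¬ A.Chain (suc k) i
  a i = A.level r i (¬∼ i)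
  b : ∀ i → ∃ λ k → k < s × B.Chain k i × ¬ B.Chain (suc k) i
  b i = B.level s i (¬≁ i)
  pair : Fin n → Fin (r * s)
  pair i = combine (fromℕ< (proj₁ (proj₂ (a i)))) (fromℕ< (proj₁ (proj₂ (b i))))
  collide : ¬ ∃₂ λ i j → i Fin.< j × pair i ≡ pair j
  collide (i , j , i<j , eq) with combine-injective _ (fromℕ< (proj₁ (proj₂ (b i)))) _ _ eq | total i<j
  ... | eqᵃ , _ | inj₁ i∼j = proj₂ (proj₂ (proj₂ (a i)))
    (j , i∼j , subst (λ k → A.Chain k j)
                 (sym (fromℕ<-injective _ _ (proj₁ (proj₂ (a i))) (proj₁ (proj₂ (a j))) eqᵃ))
                 (proj₁ (proj₂ (proj₂ (a j)))))
  ... | _ , eqᵇ | inj₂ i≁j = proj₂ (proj₂ (proj₂ (b i)))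
    (j , i≁j , subst (λ k → B.Chain k j)
                 (sym (fromℕ<-injective _ _ (proj₁ (proj₂ (b i))) (proj₁ (proj₂ (b j))) eqᵇ))
                 (proj₁ (proj₂ (proj₂ (b j)))))

-- The reverse strategy

lower-mono : ∀ {k n} (ι : Fin k → Fin (suc n)) → StrictMono ι → (∀ s → zero {n} Fin.< ι s) →
  ∃ λ (κ : Fin k → Fin n) → StrictMono κ × (∀ s → suc (κ s) ≡ ι s)
lower-mono {k} {n} ι mono positive = κ , κ-mono , suc-κ
  where
  predecessor : ∀ (i : Fin (suc n)) → zero {n} Fin.< i → ∃ λ j → suc j ≡ i
  predecessor (suc j) _ = j , refl
  κ : Fin k → Fin n
  κ s = proj₁ (predecessor (ι s) (positive s))
  suc-κ : ∀ s → suc (κ s) ≡ ι s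
  suc-κ s = proj₂ (predecessor (ι s) (positive s))
  κ-mono : StrictMono κ
  κ-mono {s} {t} s<t = s<s⁻¹ {toℕ (κ s)} {toℕ (κ t)}
    (subst₂ (λ i j → toℕ i < toℕ j) (sym (suc-κ s)) (sym (suc-κ t)) (mono s<t))

-- With its converse `⊆-tabulate⁻`, this translates between the index maps of `Contains` and the
-- sublists of the search.
tabulate-⊆ : ∀ {A : Set} {k n} (f : Fin n → A) (ι : Fin k → Fin n) → StrictMono ι →
  tabulate (f ∘ ι) ⊆ tabulate f
tabulate-⊆ {k = zero} f ι mono = minimum _
tabulate-⊆ {k = suc k} {zero} f ι mono with () ← ι zero
tabulate-⊆ {k = suc k} {suc n} f ι mono with ι zero in ι0
... | zero =
  let (κ , κ-mono , suc-κ) = lower-mono (ι ∘ suc) tail-mono positive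
  in refl ∷ subst (_⊆ tabulate (f ∘ suc)) (tabulate-cong (λ s → cong f (suc-κ s)))
                  (tabulate-⊆ (f ∘ suc) κ κ-mono)
  where
  tail-mono : StrictMono (ι ∘ suc)
  tail-mono {s} {t} s<t = mono {suc s} {suc t} (s≤s s<t)
  positive : ∀ s → zero {n} Fin.< ι (suc s)
  positive s = subst (Fin._< ι (suc s)) ι0 (mono {zero} {suc s} z<s)
... | suc i₀ =
  let (κ , κ-mono , suc-κ) = lower-mono ι mono positive
  in f zero ∷ʳ subst (_⊆ tabulate (f ∘ suc))
       (trans (tabulate-cong (λ s → cong f (suc-κ s))) (cong (λ i → f i ∷ tabulate (f ∘ ι ∘ suc)) ι0))
       (tabulate-⊆ (f ∘ suc) κ κ-mono)
  where
  ι0>0 : zero {n} Fin.< ι zero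
  ι0>0 = subst (zero {n} Fin.<_) (sym ι0) z<s
  positive : ∀ s → zero {n} Fin.< ι s
  positive zero = ι0>0
  positive (suc s) = <-trans ι0>0 (mono {zero} {suc s} z<s)

⊆-tabulate⁻ : ∀ {A : Set} {n zs} (f : Fin n → A) → zs ⊆ tabulate f →
  ∃ λ (ι : Fin (length zs) → Fin n) → StrictMono ι × tabulate (f ∘ ι) ≡ zs
⊆-tabulate⁻ {n = zero} f [] = (λ ()) , (λ { {()} }) , refl
⊆-tabulate⁻ {n = suc n} {zs} f (_ ∷ʳ τ) with ⊆-tabulate⁻ (f ∘ suc) τ
... | ι , mono , eq = suc ∘ ι , suc-mono , eq
  where
  suc-mono : StrictMono (suc ∘ ι)
  suc-mono {s} {t} s<t = s≤s (mono {s} {t} s<t)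
⊆-tabulate⁻ {n = suc n} {z ∷ zs} f (refl ∷ τ) with ⊆-tabulate⁻ (f ∘ suc) τ
... | ι , mono , eq = κ , κ-mono , cong (z ∷_) eq
  where
  κ : Fin (suc (length zs)) → Fin (suc n)
  κ zero = zero
  κ (suc s) = suc (ι s)
  κ-mono : StrictMono κ
  κ-mono {zero} {suc t} _ = z<s
  κ-mono {suc s} {suc t} (s≤s s<t) = s≤s (mono {s} {t} s<t)

-- The shape of every position in play: `A` collects the codes of the patterns chosen so far.
Avoiding : ∀ {n} → List Code → Position n
Avoiding {n} A π = ∀ (ι : Fin 4 → Fin n) → StrictMono ι → codeAt π ι ∉ A

patternCode : ∀ {k} → Perm k → Code
patternCode p = codeAt p id

⇔⇒<ᵇ : ∀ {a b c d} → (a < b ⇔ c < d) → (a <ᵇ b) ≡ (c <ᵇ d)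
⇔⇒<ᵇ {a} {b} {c} {d} e with <-≤-connex c d
... | inj₁ c<d = trans (<ᵇ-true (Equivalence.from e c<d)) (sym (<ᵇ-true c<d))
... | inj₂ d≤c = trans (<ᵇ-false (≮⇒≥ λ a<b → <⇒≱ (Equivalence.to e a<b) d≤c)) (sym (<ᵇ-false d≤c))

<ᵇ⇒⇔ : ∀ {a b c d} → (a <ᵇ b) ≡ (c <ᵇ d) → (a < b ⇔ c < d)
<ᵇ⇒⇔ eq = mk⇔ (λ a<b → <ᵇ-reflects (trans (sym eq) (<ᵇ-true a<b)))
              (λ c<d → <ᵇ-reflects (trans eq (<ᵇ-true c<d)))

Contains⇒code : ∀ {n k} (π : Perm n) (p : Perm k) → Contains π p →
  ∃ λ (ι : Fin k → Fin n) → StrictMono ι × codeAt π ι ≡ patternCode p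
Contains⇒code π p (ι , mono , same) = ι , mono ,
  tabulate-std-cong (λ t → toℕ (π ⟨ ι t ⟩)) (λ t → toℕ (p ⟨ t ⟩)) (λ s t → ⇔⇒<ᵇ (same s t))

code⇒Contains : ∀ {n k} (π : Perm n) (p : Perm k) (ι : Fin k → Fin n) → StrictMono ι →
  codeAt π ι ≡ patternCode p → Contains π p
code⇒Contains π p ι mono eq = ι , mono , λ s t →
  <ᵇ⇒⇔ (tabulate-std-reflects (λ t → toℕ (π ⟨ ι t ⟩)) (λ t → toℕ (p ⟨ t ⟩)) eq s t)

below-reverse : ∀ x ys → below x (List.reverse ys) ≡ below x ys
below-reverse x [] = refl
below-reverse x (y ∷ ys) = begin
  below x (List.reverse (y ∷ ys))      ≡⟨ cong (below x) (unfold-reverse y ys) ⟩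
  below x (List.reverse ys ++ y ∷ [])  ≡⟨ below-insertions x (List.reverse ys) (snoc∈ (List.reverse ys)) ⟩
  below x (y ∷ List.reverse ys)        ≡⟨ cong (λ m → if y <ᵇ x then suc m else m) (below-reverse x ys) ⟩
  below x (y ∷ ys)                     ∎
  where
  open ≡-Reasoning
  snoc∈ : ∀ zs → zs ++ y ∷ [] ∈ insertions y zs
  snoc∈ [] = here refl
  snoc∈ (z ∷ zs) = there (∈-map⁺ (z ∷_) (snoc∈ zs))

std-reverse : ∀ xs → std (List.reverse xs) ≡ List.reverse (std xs)
std-reverse xs = trans (map-cong (λ x → below-reverse x xs) (List.reverse xs)) (reverse-map _ xs)

patternCode-reverse : (p : Perm 4) → patternCode (reverse p) ≡ List.reverse (patternCode p)
patternCode-reverse p = std-reverse (tabulate (λ t → toℕ (p ⟨ t ⟩)))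

ReverseClosed : List Code → Set
ReverseClosed A = ∀ {c} → c ∈ A → List.reverse c ∈ A

Ascent Descent : ∀ {n} → Perm n → Rel (Fin n) 0ℓ
Ascent π i j = i Fin.< j × π ⟨ i ⟩ Fin.< π ⟨ j ⟩
Descent π i j = i Fin.< j × π ⟨ j ⟩ Fin.< π ⟨ i ⟩

ascent? : ∀ {n} (π : Perm n) → Decidable (Ascent π)
ascent? π i j = (i Finₚ.<? j) ×-dec (π ⟨ i ⟩ Finₚ.<? π ⟨ j ⟩)

descent? : ∀ {n} (π : Perm n) → Decidable (Descent π)
descent? π i j = (i Finₚ.<? j) ×-dec (π ⟨ j ⟩ Finₚ.<? π ⟨ i ⟩)

ascent⊎descent : ∀ {n} (π : Perm n) {i j} → i Fin.< j → Ascent π i j ⊎ Descent π i j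
ascent⊎descent π {i} {j} i<j with <-cmp (toℕ (π ⟨ i ⟩)) (toℕ (π ⟨ j ⟩))
... | tri< lt _ _ = inj₁ (i<j , lt)
... | tri≈ _ eq _ = contradiction (cong toℕ (proj₂ π (toℕ-injective eq))) (<⇒≢ i<j)
... | tri> _ _ gt = inj₂ (i<j , gt)

-- A reverse-closed `A` containing one monotone code contains both, and `π` is too long to avoid
-- both.
monotone∉ : ∀ {n} → 10 ≤ n → ∀ {A} → ReverseClosed A → ∀ {π : Perm n} → Avoiding A π →
  ∀ {c} → c ∈ monotoneCodes → ¬ c ∈ A
monotone∉ {n} 10≤n {A} closed {π} av {c} c∈ c∈A =
  -- Here `10≤n` serves as `3 * 3 < n`.
  erdős–szekeres (ascent? π) (descent? π) (ascent⊎descent π) 10≤n no-ascents no-descents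
  where
  both : ∀ {c} → c ∈ monotoneCodes → c ∈ A → (0 ∷ 1 ∷ 2 ∷ 3 ∷ []) ∈ A × (3 ∷ 2 ∷ 1 ∷ 0 ∷ []) ∈ A
  both (here refl) c∈A = c∈A , closed c∈A
  both (there (here refl)) c∈A = closed c∈A , c∈A
  no-ascents : ∀ i → ¬ Chains.Chain (Ascent π) (ascent? π) 3 i
  no-ascents i ch = av ι (λ s<t → proj₁ (rises s<t)) (subst (_∈ A) (sym code) (proj₁ (both c∈ c∈A)))
    where
    open Chains (Ascent π) (ascent? π)
    ι : Fin 4 → Fin n
    ι = chainPath 3 ch
    rises : ∀ {s t} → s Fin.< t → Ascent π (ι s) (ι t)
    rises = chainPath-∼ (λ (i<j , lt) (j<k , lt′) → <-trans i<j j<k , <-trans lt lt′) 3 ch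
    code : codeAt π ι ≡ 0 ∷ 1 ∷ 2 ∷ 3 ∷ []
    code = tabulate-std-cong (λ t → toℕ (π ⟨ ι t ⟩)) toℕ
             (mono-<ᵇ {ι = λ t → π ⟨ ι t ⟩} (λ s<t → proj₂ (rises s<t)))
  no-descents : ∀ i → ¬ Chains.Chain (Descent π) (descent? π) 3 i
  no-descents i ch = av ι (λ s<t → proj₁ (falls s<t)) (subst (_∈ A) (sym code) (proj₂ (both c∈ c∈A)))
    where
    open Chains (Descent π) (descent? π)
    ι : Fin 4 → Fin n
    ι = chainPath 3 ch
    falls : ∀ {s t} → s Fin.< t → Descent π (ι s) (ι t)
    falls = chainPath-∼ (λ (i<j , gt) (j<k , gt′) → <-trans i<j j<k , <-trans gt′ gt) 3 ch
    code : codeAt π ι ≡ 3 ∷ 2 ∷ 1 ∷ 0 ∷ []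
    -- `3 ∸ toℕ t` computes to `orient false 4 (toℕ t)`, so `orient-false-<ᵇ` applies.
    code = tabulate-std-cong (λ t → toℕ (π ⟨ ι t ⟩)) (λ t → 3 ∸ toℕ t) same
      where
      same : ∀ s t →
        (toℕ (π ⟨ ι s ⟩) <ᵇ toℕ (π ⟨ ι t ⟩)) ≡ (orient false 4 (toℕ s) <ᵇ orient false 4 (toℕ t))
      same s t rewrite orient-false-<ᵇ {4} {toℕ s} {toℕ t} (toℕ<n s) with Finₚ.<-cmp s t
      ... | tri< s<t _ _ = trans (<ᵇ-false (<⇒≤ (proj₂ (falls s<t)))) (sym (<ᵇ-false (<⇒≤ s<t)))
      ... | tri≈ _ refl _ = trans (<ᵇ-false (≤-refl {toℕ (π ⟨ ι s ⟩)})) (sym (<ᵇ-false (≤-refl {toℕ s})))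
      ... | tri> _ _ t<s = trans (<ᵇ-true (proj₂ (falls t<s))) (sym (<ᵇ-true t<s))

∈-candidates : ∀ c css {cs} → cs ∈ candidates c css → cs ∈ css × ¬ c ∈ cs × List.reverse c ∈ cs
∈-candidates c (ds ∷ css) cs∈ with elem c ds in c∈ds | elem (List.reverse c) ds in rc∈ds
... | true | _ = Product.map₁ there (∈-candidates c css cs∈)
... | false | false = Product.map₁ there (∈-candidates c css cs∈)
∈-candidates c (ds ∷ css) (here refl) | false | true =
  here refl , (λ c∈ → contradiction (trans (sym (elem-complete c∈)) c∈ds) λ ()) , elem-sound ds rc∈ds
∈-candidates c (ds ∷ css) (there cs∈) | false | true = Product.map₁ there (∈-candidates c css cs∈)

-- The candidates are a variable, so that the search is only ever evaluated in search-succeeds.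
search-at : ∀ css → searchSucceeds css ≡ true → ∀ {c} → c ∈ perms 4 →
  search 3 (map prepare (candidates c css)) c ≡ true
search-at css succeeds = all-sound {p = λ c → search 3 (map prepare (candidates c css)) c} (perms 4) succeeds

prepare-allowed : ∀ {Allowed : Code → Set} → (∀ {c} → Allowed c → Allowed (List.reverse c)) →
  All Allowed monotoneCodes → ∀ cs → All Allowed (prepare cs) → All Allowed cs
prepare-allowed {Allowed} allowed-reverse mono✓ cs cs✓ = keep-allowed Allowed allowed-reverse cs mono✓
  (All.tabulate λ d∈ → canon-allowed Allowed allowed-reverse (All.lookup cs✓ (∈-nub⁺ (∈-map⁺ canon d∈))))

succeeding-family : ∀ {Allowed : Code → Set} → (∀ {c} → Allowed c → Allowed (List.reverse c)) →
  All Allowed monotoneCodes → ∀ fs c →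
  (∃ λ m → m ∈ map prepare (candidates c (map familyCodes fs)) × All Allowed m) →
  ∃ λ F → F ∈ fs × All Allowed (familyCodes F) × ¬ c ∈ familyCodes F × List.reverse c ∈ familyCodes F
succeeding-family allowed-reverse mono✓ fs c (m , m∈ , m✓) with ∈-map⁻ prepare m∈
... | cs , cs∈ , refl with ∈-candidates c (map familyCodes fs) cs∈
... | cs∈css , c∉cs , rc∈cs with ∈-map⁻ familyCodes cs∈css
... | F , F∈ , refl = F , F∈ , prepare-allowed allowed-reverse mono✓ (familyCodes F) m✓ , c∉cs , rc∈cs

module _ {Allowed : Code → Set} (allowed-reverse : ∀ {c} → Allowed c → Allowed (List.reverse c))
         {xs : List ℕ} (uq : Unique xs) (7≤ : 7 ≤ length xs)
         (xs✓ : ∀ {zs} → zs ⊆ xs → length zs ≡ 4 → Allowed (std zs)) where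

  candidate-exists : ∀ css → searchSucceeds css ≡ true → ∀ {ys} → ys ⊆ xs → length ys ≡ 4 →
    ∃ λ m → m ∈ map prepare (candidates (std ys) css) × All Allowed m
  candidate-exists css succeeds {ys} ys⊆xs len =
    search-sound Allowed allowed-reverse xs uq xs✓ 3 (map prepare (candidates (std ys) css)) {ys} ys⊆xs room
      (search-at css succeeds {std ys} std∈)
    where
    -- The 7 points are the 4 of the chosen pattern and the 3 levels of extension.
    room : length ys + 3 ≤ length xs
    room = subst (λ l → l + 3 ≤ length xs) (sym len) 7≤
    std∈ : std ys ∈ perms 4
    std∈ = subst (λ l → std ys ∈ perms l) len (std-perms ys (unique-⊆ ys⊆xs uq))

inflation : ∀ F → Fits F → ∀ {n} → 10 ≤ n → ∃ λ (ρ : Perm n) →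
  (∀ (ι : Fin 4 → Fin n) → StrictMono ι → codeAt ρ ι ∈ familyCodes F) ×
  (∀ {c} → c ∈ familyCodes F → ∃ λ (ι : Fin 4 → Fin n) → StrictMono ι × codeAt ρ ι ≡ c)
inflation F (r<k , k≤7) {n} 10≤n = resize (m+[n∸m]≡n (≤-trans k≤7 (≤-trans (m≤m+n 7 3) 10≤n)))
  where
  -- The bound `3 ≤ e` arises as `10 ∸ 7`.
  open Realise F (n ∸ length (Family.word F)) (∸-mono 10≤n k≤7) r<k
    using (perm; code∈familyCodes; familyCodes-occur)
  resize : ∀ {n′} → length (Family.word F) + (n ∸ length (Family.word F)) ≡ n′ → ∃ λ (ρ : Perm n′) →
    (∀ (ι : Fin 4 → Fin n′) → StrictMono ι → codeAt ρ ι ∈ familyCodes F) ×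
    (∀ {c} → c ∈ familyCodes F → ∃ λ (ι : Fin 4 → Fin n′) → StrictMono ι × codeAt ρ ι ≡ c)
  resize refl = perm , (λ ι mono → code∈familyCodes {ι} mono) , familyCodes-occur

Reply : ℕ → List Code → Code → Set
Reply n A c = ∃ λ (ρ : Perm n) → Avoiding (c ∷ A) ρ ×
  ∃ λ (ι : Fin 4 → Fin n) → StrictMono ι × codeAt ρ ι ≡ List.reverse c

reply-family : ∀ {n A c} → 10 ≤ n → ∀ F → Fits F → All (λ d → ¬ d ∈ A) (familyCodes F) →
  ¬ c ∈ familyCodes F → List.reverse c ∈ familyCodes F → Reply n A c
reply-family {n} {A} {c} 10≤n F fits F✓ c∉ rc∈ with inflation F fits 10≤n
... | ρ , codes , occurs = ρ , avoids , occurs rc∈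
  where
  avoids : Avoiding (c ∷ A) ρ
  avoids ι mono (here eq) = c∉ (subst (_∈ familyCodes F) eq (codes ι mono))
  avoids ι mono (there ∈A) = All.lookup F✓ (codes ι mono) ∈A

-- The search is run on the values of `π`, starting from the occurrence `κ`. It yields an inflation
-- with all codes outside `A`, which therefore survives all earlier choices as well as the new one.
reply : ∀ {n} → 10 ≤ n → ∀ {A} → ReverseClosed A → ∀ {π : Perm n} → Avoiding A π →
  ∀ (κ : Fin 4 → Fin n) → StrictMono κ → Reply n A (codeAt π κ)
reply {n} 10≤n {A} closed {π} av κ κ-mono =
  let (F , F∈ , F✓ , c∉ , rc∈) = succeeding-family {Allowed} allowed-reverse
        (All.tabulate (monotone∉ 10≤n closed {π} av)) allFamilies (codeAt π κ)
        (candidate-exists {Allowed} allowed-reverse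
          (tabulate⁺ (λ eq → proj₂ π (toℕ-injective eq)))
          (subst (7 ≤_) (sym (length-tabulate values)) (≤-trans (m≤m+n 7 3) 10≤n))
          allowed (map familyCodes allFamilies) search-succeeds {tabulate (values ∘ κ)}
          (tabulate-⊆ values κ κ-mono) (length-tabulate (values ∘ κ)))
  in reply-family 10≤n F (All.lookup families-fit F∈) F✓ c∉ rc∈
  where
  values : Fin n → ℕ
  values i = toℕ (π ⟨ i ⟩)
  Allowed : Code → Set
  Allowed c = ¬ c ∈ A
  allowed-reverse : ∀ {c} → Allowed c → Allowed (List.reverse c)
  allowed-reverse {c} c∉ rc∈ = c∉ (subst (_∈ A) (reverse-involutive c) (closed rc∈))
  at-four : ∀ {k} → k ≡ 4 → (ι : Fin k → Fin n) → StrictMono ι → Allowed (codeAt π ι)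
  at-four refl = av
  allowed : ∀ {zs} → zs ⊆ tabulate values → length zs ≡ 4 → Allowed (std zs)
  allowed zs⊆ len =
    let (ι , mono , eq) = ⊆-tabulate⁻ values zs⊆
    in subst Allowed (cong std eq) (at-four len ι mono)

-- The code `c` is a separate argument so that for the reply it can be
-- `List.reverse (patternCode p)`, which keeps the closure under reversal visible.
Avoiding-∷ : ∀ {n} {X : Position n} {A c} (p : Perm 4) → patternCode p ≡ c →
  (∀ π → X π ⇔ Avoiding A π) → ∀ π → move X p π ⇔ Avoiding (c ∷ A) π
Avoiding-∷ {X = X} {A} p refl X⇔A π = mk⇔ to from
  where
  to : move X p π → Avoiding (patternCode p ∷ A) π
  to (Xπ , π∌p) ι mono (here eq) = π∌p (code⇒Contains π p ι mono eq)
  to (Xπ , π∌p) ι mono (there ∈A) = Equivalence.to (X⇔A π) Xπ ι mono ∈A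
  from : Avoiding (patternCode p ∷ A) π → move X p π
  from av = Equivalence.from (X⇔A π) (λ ι mono ∈A → av ι mono (there ∈A)) ,
    λ π∋p → let (ι , mono , eq) = Contains⇒code π p π∋p in av ι mono (here eq)

-- The invariant at Player I's turns is that `A` is reverse-closed: a round adds a code together
-- with its reverse. The recursion is on termination of play.
reverse-strategy : ∀ {n} → 10 ≤ n → ∀ {X : Position n} {A} → Terminates 4 X → ReverseClosed A →
  (∀ π → X π ⇔ Avoiding A π) → RevWins 4 X
respond : ∀ {n} → 10 ≤ n → ∀ {X : Position n} {A} p → Terminates 4 (move X p) → ReverseClosed A →
  (∀ π → X π ⇔ Avoiding A π) → Reply n A (patternCode p) →
  Σ (Legal (move X p) (reverse p)) (λ _ → RevWins 4 (move (move X p) (reverse p)))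

reverse-strategy {n} 10≤n {X} {A} (terminates rec) closed X⇔A = rw λ p l@(π , Xπ , π∋p) →
  let (κ , κ-mono , κ-code) = Contains⇒code π p π∋p
  in respond 10≤n p (rec p l) closed X⇔A
       (subst (Reply n A) κ-code (reply 10≤n closed {π} (Equivalence.to (X⇔A π) Xπ) κ κ-mono))

respond 10≤n {X} {A} p (terminates rec) closed X⇔A (ρ , ρ-avoids , ι , ι-mono , ι-code) =
  l , reverse-strategy 10≤n (rec (reverse p) l) closed′
        (Avoiding-∷ (reverse p) (patternCode-reverse p) X⇔A′)
  where
  X⇔A′ : ∀ π → move X p π ⇔ Avoiding (patternCode p ∷ A) π
  X⇔A′ = Avoiding-∷ p refl X⇔A
  l : Legal (move X p) (reverse p)
  l = ρ , Equivalence.from (X⇔A′ ρ) ρ-avoids ,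
      code⇒Contains ρ (reverse p) ι ι-mono (trans ι-code (sym (patternCode-reverse p)))
  closed′ : ReverseClosed (List.reverse (patternCode p) ∷ patternCode p ∷ A)
  closed′ (here refl) = there (here (reverse-involutive (patternCode p)))
  closed′ (there (here refl)) = here refl
  closed′ (there (there d∈)) = there (there (closed d∈))

theorem6p12 : (n : ℕ) → 10 ≤ n → RevWins 4 (Sn n) × SG 4 (Sn n) 0

theorem6p12 n 10≤n = wins , subst (SG 4 (Sn n)) (RevWins⇒SG≡0 wins (proj₂ value)) (proj₂ value)
  where
  wins : RevWins 4 (Sn n)
  wins = reverse-strategy 10≤n {A = []} (position-terminates (Sn n)) (λ ()) (λ π → mk⇔ (λ _ _ _ ()) (λ _ → tt))
  value : ∃ λ v → SG 4 (Sn n) v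
  value = SG-exists (position-terminates (Sn n)) (Sn-dec n)
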